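{- Let $w$ be a word of length $f\ge1$ in $\Gamma_n$, let $(P,Q)$ be its Berele $P$- and $Q$-symbols, $Q=(\kappa^{(0)},\dots,\kappa^{(f)})$, and let $P^{(f-1)}$ be the Berele $P$-symbol of the word obtained from $w$ by deleting the rightmost occurrence of the largest letter of $w$. Put $l=\max\{\ell(\kappa^{(j)}):0\le j\le f\}$, and let the largest letter of $P$ be $\gamma\in\{m,\bar m\}$ with $m\in[1,n]$. (1) If $m>l$, then $\gamma$ is the largest letter of $w$, and $P^{(f-1)}$ is obtained from $P$ by deleting the rightmost occurrence of $\gamma$. Assume from now on that $m\le l$. (2) If $P$ contains the letter $\bar l$, then $\bar l$ is the largest letter of $w$, and $P^{(f-1)}$ is obtained from $P$ by deleting the rightmost occurrence of $\bar l$. (3) If $P$ does not contain $\bar l$ and there is no $j$ with $\kappa^{(j-1)}\supset_l\kappa^{(j)}$, then $l$ is the largest letter of $w$ (and of $P$), and $P^{(f-1)}$ is obtained from $P$ by deleting the rightmost occurrence of $l$. Now suppose $P$ does not contain $\bar l$ and there is some $j$ with $\kappa^{(j-1)}\supset_l\kappa^{(j)}$. Let $\bar P$ be the tableau obtained from $P$ by adding a letter $l$ at the bottom of the leftmost column of $P$ that does not already contain $l$. Run the following backward test: set $\sigma_f=\mathrm{sh}(\bar P)$ and, for $j=f,f-1,\dots$, as long as $\sigma_j\supset\!\cdot\,\kappa^{(j)}$ and $j\ge1$, apply the local rules backwards to the cell with $\Lambda(B)=\sigma_j$, $\Lambda(C)=\kappa^{(j-1)}$, $\Lambda(D)=\kappa^{(j)}$,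 regarded as lying in the $\bar l$-stratum, and let $\sigma_{j-1}$ be the resulting $\Lambda(A)$. (4) If this test reaches the leftmost edge, i.e. it produces $\sigma_0$ with $\sigma_0\supset\!\cdot\,\kappa^{(0)}$, then $P^{(f-1)}\ne\bar P$; in this case $l$ is the largest letter of $w$ (and of $P$), and $P^{(f-1)}$ is obtained from $P$ by deleting the rightmost occurrence of $l$. (5) If the case $(\bigcirc)$ is encountered at some cell before reaching the leftmost edge, then $P^{(f-1)}=\bar P$, and the largest letter of $w$ is $\bar l$.
   Context: Partitions are identified with Young diagrams in matrix coordinates; $\ell(\lambda)$ is the number of nonzero parts. $\mu\subset_k\lambda$ (equivalently $\lambda\supset_k\mu$) means $\lambda$ is $\mu$ plus one cell in row $k$; $\mu\subset\!\cdot\,\lambda$ (equivalently $\lambda\supset\!\cdot\,\mu$) means $\mu\subset_k\lambda$ for some $k$. A domino is a skew shape of two cells adjacent in a row or a column. $\Gamma_n=\{1<\bar1<2<\bar2<\cdots<n<\bar n\}$. An $Sp(2n)$-tableau: entries in $\Gamma_n$, rows weakly increasing, columns strictly increasing, entries of row $i$ at least $i$. Row insertion: insert $x$ into row 1; the leftmost entry strictly larger than $x$ is replaced by $x$ and bumped into the next row similarly; if none, $x$ is appended. Jeu de taquin slide of a hole at $(i,j)$: if $(i+1,j)$ is in the shape and either $(i,j+1)$ is not or $T(i+1,j)\le T(i,j+1)$, move the entry of $(i+1,j)$ into the hole, otherwise the entry of $(i,j+1)$; repeat until the hole has no neighbour below or to the right, then delete it. Berele insertion $T\leftarrow_{\mathcal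 B}x$: row insert $x$; if the result is an $Sp(2n)$-tableau, done; otherwise at the earliest stage where a letter $\bar k$ in row $k$ is bumped by a letter $k$, erase this $k$ and $\bar k$, leave a hole at the former position of $\bar k$ and slide it out by jeu de taquin. Berele's correspondence: $P_i=(\cdots(\varnothing\leftarrow_{\mathcal B}w_1)\cdots)\leftarrow_{\mathcal B}w_i$; $P=P_f$ and $Q=(\mathrm{sh}(P_0),\dots,\mathrm{sh}(P_f))$ (an up-down tableau: consecutive shapes differ by adding or removing one cell). Local rules, applied to a cell with vertices $A$ (top-left), $B$ (top-right), $C$ (bottom-left), $D$ (bottom-right), carrying shapes $\Lambda(\cdot)$, lying in a $\gamma$-stratum ($\gamma\in\Gamma_n$), with contents either empty or $\times$. The cases: carry-over (empty): all four equal; or $\Lambda(A)=\Lambda(B)\ne\Lambda(C)=\Lambda(D)$; or $\Lambda(A)=\Lambda(C)\ne\Lambda(B)=\Lambda(D)$. $(\times)$: contains $\times$, $\Lambda(A)=\Lambda(B)=\Lambda(C)\subset_1\Lambda(D)$. (M) empty, $k\ne k'$: $\Lambda(A)\subset_k\Lambda(B)$, $\Lambda(A)\subset_{k'}\Lambda(C)$, $\Lambda(B)\subset_{k'}\Lambda(D)$, $\Lambda(C)\subset_k\Lambda(D)$. (R) empty: $\Lambda(A)\subset_k\Lambda(B)=\Lambda(C)\subset_{k+1}\Lambda(D)$, $\gamma\ge k+1$. $(\bigcirc)$ empty: $\Lambda(A)\subset_k\Lambda(B)=\Lambda(C)\supset_k\Lambda(D)$, $\gamma\le\bar k$. $(\bar{\mathrm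 J})$ empty: $\Lambda(C)\subset\!\cdot\,\Lambda(A)\subset\!\cdot\,\Lambda(B)$, $\Lambda(C)\subset\!\cdot\,\Lambda(D)\subset\!\cdot\,\Lambda(B)$, $\Lambda(B)/\Lambda(C)$ a domino, $\Lambda(A)=\Lambda(D)$. (J) as $(\bar{\mathrm J})$ but not a domino and $\Lambda(A)\ne\Lambda(D)$. $(\bar{\mathrm J}')$ empty: $\Lambda(B)\subset\!\cdot\,\Lambda(A)\subset\!\cdot\,\Lambda(C)$, $\Lambda(B)\subset\!\cdot\,\Lambda(D)\subset\!\cdot\,\Lambda(C)$, $\Lambda(C)/\Lambda(B)$ a domino, $\Lambda(A)=\Lambda(D)$. (J$'$) as $(\bar{\mathrm J}')$ but not a domino and $\Lambda(A)\ne\Lambda(D)$. (W) empty, $k\ne k'$: $\Lambda(A)\supset_k\Lambda(B)$, $\Lambda(A)\supset_{k'}\Lambda(C)$, $\Lambda(B)\supset_{k'}\Lambda(D)$, $\Lambda(C)\supset_k\Lambda(D)$. (Ya) empty, $k\ge2$: $\Lambda(A)\supset_k\Lambda(B)=\Lambda(C)\supset_{k-1}\Lambda(D)$. Applying the local rules backwards means: given $\gamma$ and $\Lambda(B),\Lambda(C),\Lambda(D)$, take the case of this list compatible with these data and set $\Lambda(A)$ (and the cell contents) accordingly; "encountering case $(\bigcirc)$" means that this compatible case is $(\bigcirc)$. -}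

module Defs where

open import Data.Nat using (ℕ; zero; suc; _+_; _*_; _≤_; _<_; _⊔_; _≡ᵇ_; _≤ᵇ_; _<ᵇ_)
open import Data.Bool using (Bool; true; false; if_then_else_; _∧_; _∨_; not)
open import Data.List using (List; []; _∷_; _++_; length; map; concat; reverse; upTo; foldr)
open import Data.Nat.ListAction using (sum)
open import Data.List.Relation.Unary.Any using (Any)
open import Data.Maybe using (Maybe; just; nothing)
open import Data.Product using (_×_; _,_; proj₁; proj₂; ∃)
open import Relation.Binary.PropositionalEquality using (_≡_)

-- The alphabet Γ_n = {1 < 1̄ < 2 < 2̄ < ... < n < n̄}

data Letter : Set where
  plain : ℕ → Letter
  bar   : ℕ → Letter

idx : Letter → ℕ
idx (plain k) = k
idx (bar k)   = k

code : Letter → ℕ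
code (plain k) = 2 * k
code (bar k)   = suc (2 * k)

_≤L_ : Letter → Letter → Bool
x ≤L y = code x ≤ᵇ code y

_<L_ : Letter → Letter → Bool
x <L y = code x <ᵇ code y

_==L_ : Letter → Letter → Bool
plain a ==L plain b = a ≡ᵇ b
bar a   ==L bar b   = a ≡ᵇ b
_       ==L _       = false

InΓ : ℕ → Letter → Set
InΓ n x = (1 ≤ idx x) × (idx x ≤ n)

maxL : Letter → Letter → Letter
maxL x y = if x ≤L y then y else x

largest : List Letter → Maybe Letter
largest []       = nothing
largest (x ∷ xs) with largest xs
... | nothing = just x
... | just y  = just (maxL x y)

deleteLast : Letter → List Letter → List Letter
deleteLast x w = reverse (go (reverse w))
  where
  go : List Letter → List Letter
  go []       = []
  go (y ∷ ys) = if y ==L x then ys else y ∷ go ys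

dropLargest : List Letter → List Letter
dropLargest w with largest w
... | nothing = w
... | just x  = deleteLast x w

nth : {A : Set} → List A → ℕ → Maybe A
nth []       _       = nothing
nth (x ∷ xs) zero    = just x
nth (x ∷ xs) (suc i) = nth xs i

setAt : {A : Set} → List A → ℕ → A → List A
setAt []       _       _ = []
setAt (x ∷ xs) zero    a = a ∷ xs
setAt (x ∷ xs) (suc i) a = x ∷ setAt xs i a

modifyAt : {A : Set} → List A → ℕ → (A → A) → List A
modifyAt []       _       f = []
modifyAt (x ∷ xs) zero    f = f x ∷ xs
modifyAt (x ∷ xs) (suc i) f = x ∷ modifyAt xs i f

removeAt : {A : Set} → List A → ℕ → List A
removeAt []       _       = []
removeAt (x ∷ xs) zero    = xs
removeAt (x ∷ xs) (suc i) = x ∷ removeAt xs i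

findFirst : (ℕ → Bool) → List ℕ → Maybe ℕ
findFirst p []       = nothing
findFirst p (k ∷ ks) = if p k then just k else findFirst p ks

-- Tableaux (list of rows, top row first) and shapes (partitions as
-- lists of positive row lengths)

Tab : Set
Tab = List (List Letter)

Shape : Set
Shape = List ℕ

shape : Tab → Shape
shape = map length

ℓ : Shape → ℕ
ℓ []             = 0
ℓ (zero ∷ xs)    = ℓ xs
ℓ (suc _ ∷ xs)   = suc (ℓ xs)

dropEmpty : Tab → Tab
dropEmpty []             = []
dropEmpty ([] ∷ rs)      = dropEmpty rs
dropEmpty ((x ∷ r) ∷ rs) = (x ∷ r) ∷ dropEmpty rs

get : Tab → ℕ → ℕ → Maybe Letter
get T i j with nth T i
... | nothing = nothing
... | just r  = nth r j

set : Tab → ℕ → ℕ → Letter → Tab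
set T i j a = modifyAt T i (λ r → setAt r j a)

deleteCell : Tab → ℕ → ℕ → Tab
deleteCell T i j = dropEmpty (modifyAt T i (λ r → removeAt r j))

size : Tab → ℕ
size T = sum (map length T) + length T

-- Jeu de taquin slide of a hole at (i,j) (0-based).  The entry stored at
-- the hole is irrelevant (it gets overwritten or deleted).  Each step moves
-- the hole down or right, so 'size T' steps of fuel always suffice.

slide : ℕ → Tab → ℕ → ℕ → Tab
slide zero T i j = deleteCell T i j
slide (suc f) T i j with get T (suc i) j | get T i (suc j)
... | nothing | nothing = deleteCell T i j
... | just b  | nothing = slide f (set T i j b) (suc i) j
... | nothing | just r  = slide f (set T i j r) i (suc j)
... | just b  | just r  =
  if b ≤L r then slide f (set T i j b) (suc i) j
            else slide f (set T i j r) i (suc j)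

bump : Letter → List Letter → Maybe (ℕ × Letter)
bump x []       = nothing
bump x (y ∷ ys) with x <L y
... | true  = just (0 , y)
... | false with bump x ys
...   | nothing      = nothing
...   | just (j , z) = just (suc j , z)

data InsRes : Set where
  done : Tab → InsRes
  hole : ℕ → ℕ → Tab → InsRes   -- hole at (row, column), 0-based

prependRow : List Letter → InsRes → InsRes
prependRow r (done T)     = done (r ∷ T)
prependRow r (hole i j T) = hole (suc i) j (r ∷ T)

isCancel : ℕ → Letter → Letter → Bool
isCancel k x y = (x ==L plain k) ∧ (y ==L bar k)

-- row insertion of x into the rows starting at row number i (1-based),
-- stopping at the earliest stage where k̄ in row k is bumped by k
insGo : ℕ → Letter → Tab → InsRes
insGo i x []       = done ((x ∷ []) ∷ [])
insGo i x (r ∷ rs) with bump x r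
... | nothing      = done ((r ++ (x ∷ [])) ∷ rs)
... | just (j , y) =
  if isCancel i x y then hole 0 j (r ∷ rs)
  else prependRow (setAt r j x) (insGo (suc i) y rs)

berIns : Tab → Letter → Tab
berIns T x with insGo 1 x T
... | done T'     = T'
... | hole i j T' = slide (size T') T' i j

tabsFrom : Tab → List Letter → List Tab
tabsFrom T []       = T ∷ []
tabsFrom T (x ∷ xs) = T ∷ tabsFrom (berIns T x) xs

berP : List Letter → Tab
berP []       = []
berP w = go [] w
  where
  go : Tab → List Letter → Tab
  go T []       = T
  go T (x ∷ xs) = go (berIns T x) xs

berQ : List Letter → List Shape
berQ w = map shape (tabsFrom [] w)

addCell : ℕ → Shape → Maybe Shape
addCell zero _                    = nothing
addCell (suc zero) []             = just (1 ∷ [])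
addCell (suc zero) (x ∷ xs)       = just (suc x ∷ xs)
addCell (suc (suc k)) []          = nothing
addCell (suc (suc k)) (x ∷ xs) with addCell (suc k) xs
... | nothing = nothing
... | just ys = just (x ∷ ys)

_⊂[_]_ : Shape → ℕ → Shape → Set
μ ⊂[ k ] ν = addCell k μ ≡ just ν

consec : {A : Set} → List A → List (A × A)
consec []           = []
consec (x ∷ [])     = []
consec (x ∷ y ∷ xs) = (x , y) ∷ consec (y ∷ xs)

HasRemovalInRow : ℕ → List Shape → Set
HasRemovalInRow l Q = Any (λ p → proj₂ p ⊂[ l ] proj₁ p) (consec Q)

eqShape : Shape → Shape → Bool
eqShape []       []       = true
eqShape (x ∷ xs) (y ∷ ys) = (x ≡ᵇ y) ∧ eqShape xs ys
eqShape _        _        = false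

eqMShape : Maybe Shape → Shape → Bool
eqMShape nothing  _ = false
eqMShape (just x) y = eqShape x y

coverRow : Shape → Shape → Maybe ℕ
coverRow μ ν = findFirst (λ k → eqMShape (addCell k μ) ν) (map suc (upTo (suc (length μ))))

isCover : Shape → Shape → Bool
isCover μ ν with coverRow μ ν
... | nothing = false
... | just _  = true

part : Shape → ℕ → ℕ
part ν zero = 0
part ν (suc k) with nth ν k
... | nothing = 0
... | just a  = a

adjacent : ℕ × ℕ → ℕ × ℕ → Bool
adjacent (i , j) (i' , j') =
  ((i ≡ᵇ i') ∧ ((suc j ≡ᵇ j') ∨ (suc j' ≡ᵇ j))) ∨
  ((j ≡ᵇ j') ∧ ((suc i ≡ᵇ i') ∨ (suc i' ≡ᵇ i)))

-- Local rules applied backwards, in the regime Λ(B) ⊃· Λ(D) used in the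
-- backward test.  In this regime the only cases of the list whose
-- shape pattern can fit are (○), (Ya), (W), (J̄), (J).

data Case : Set where
  caseCirc caseYa caseW caseJbar caseJ : Case

backStep : Letter → Shape → Shape → Shape → Maybe (Case × Shape)
backStep γ B C D with coverRow D B
... | nothing = nothing
... | just kd with coverRow D C
...   | just k =
  if eqShape B C
  then (if γ ≤L bar k then just (caseCirc , D)
        else (addCellA caseYa (suc k) B))
  else (if k ≡ᵇ kd then nothing else addCellA caseW kd C)
  where
  addCellA : Case → ℕ → Shape → Maybe (Case × Shape)
  addCellA c r S with addCell r S
  ... | nothing = nothing
  ... | just A  = just (c , A)
...   | nothing with coverRow C D
...     | nothing = nothing
...     | just k' =
  if adjacent (k' , part D k') (kd , part B kd)
  then just (caseJbar , D)
  else jA (addCell kd C)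
  where
  jA : Maybe Shape → Maybe (Case × Shape)
  jA nothing  = nothing
  jA (just A) = just (caseJ , A)

data TestResult : Set where
  edge   : TestResult
  circle : TestResult
  stuck  : TestResult

-- runs the test given σ_j and the list κ^(j), κ^(j-1), ..., κ^(0)
runTest : Letter → Shape → List Shape → TestResult
runTest γ σ []         = stuck
runTest γ σ (κ ∷ rest) = go σ κ rest
  where
  go : Shape → Shape → List Shape → TestResult
  go σ κ [] = if isCover κ σ then edge else stuck
  go σ κ (κ' ∷ rest) with isCover κ σ
  ... | false = stuck
  ... | true with backStep γ σ κ' κ
  ...   | nothing              = stuck
  ...   | just (caseCirc , _)  = circle
  ...   | just (caseYa , A)    = go A κ' rest
  ...   | just (caseW , A)     = go A κ' rest
  ...   | just (caseJbar , A)  = go A κ' rest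
  ...   | just (caseJ , A)     = go A κ' rest

columnHas : Tab → ℕ → Letter → Bool
columnHas []       j x = false
columnHas (r ∷ rs) j x with nth r j
... | nothing = columnHas rs j x
... | just y  = (y ==L x) ∨ columnHas rs j x

colHeight : Tab → ℕ → ℕ
colHeight []       j = 0
colHeight (r ∷ rs) j = if j <ᵇ length r then suc (colHeight rs j) else colHeight rs j

firstRowLength : Tab → ℕ
firstRowLength []      = 0
firstRowLength (r ∷ _) = length r

appendToRow : Tab → ℕ → Letter → Tab
appendToRow []       _       x = (x ∷ []) ∷ []
appendToRow (r ∷ rs) zero    x = (r ++ (x ∷ [])) ∷ rs
appendToRow (r ∷ rs) (suc h) x = r ∷ appendToRow rs h x

addAtBottomOfLeftmostColumnWithout : Letter → Tab → Tab
addAtBottomOfLeftmostColumnWithout x P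
  with findFirst (λ j → not (columnHas P j x)) (upTo (suc (firstRowLength P)))
... | nothing = P
... | just j  = appendToRow P (colHeight P j) x

Pbar : ℕ → Tab → Tab
Pbar l P = addAtBottomOfLeftmostColumnWithout (plain l) P

backTest : ℕ → List Letter → TestResult
backTest l w = runTest (bar l) (shape (Pbar l (berP w))) (reverse (berQ w))

lastOcc : Letter → List Letter → Maybe ℕ
lastOcc x r = go 0 r nothing
  where
  go : ℕ → List Letter → Maybe ℕ → Maybe ℕ
  go i []       acc = acc
  go i (y ∷ ys) acc = go (suc i) ys (if y ==L x then just i else acc)

rightmostOcc : Letter → Tab → Maybe (ℕ × ℕ)
rightmostOcc x T = go 0 T nothing
  where
  better : ℕ → ℕ → Maybe (ℕ × ℕ) → Maybe (ℕ × ℕ)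
  better i j nothing        = just (i , j)
  better i j (just (i' , j')) = if j' <ᵇ j then just (i , j) else just (i' , j')
  go : ℕ → Tab → Maybe (ℕ × ℕ) → Maybe (ℕ × ℕ)
  go i []       acc = acc
  go i (r ∷ rs) acc with lastOcc x r
  ... | nothing = go (suc i) rs acc
  ... | just j  = go (suc i) rs (better i j acc)

deleteRightmost : Letter → Tab → Tab
deleteRightmost x T with rightmostOcc x T
... | nothing      = T
... | just (i , j) = deleteCell T i j

maxℓ : List Shape → ℕ
maxℓ Q = foldr (λ κ m → ℓ κ ⊔ m) 0 Q

{-# OPTIONS --safe #-}
-- Peel a tableau T letter by letter: T is the tableau S of its letters below M, to
-- which the copies of M add a horizontal strip, a i of them in row i.  An insertion
-- of x < M changes the shape μ of S by one cell, and then the strip by a local rule: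
--   * μ gains a cell in row k: if a k = 0 nothing else happens; otherwise an M is bumped
--     from row k to row k + 1, or, if M is the barred letter of row k, it is cancelled;
--   * μ loses a cell in row k: the hole moves on into row k + 1 exactly if
--     μ (k + 1) + a (k + 1) = μ k, which turns an M of row k + 1 into one of row k.
-- Now write w = u M v with M the largest letter and v below M, and follow the runs of
-- w and of u v.  At first the tableaux differ by the rightmost M.  This can only end by
-- a cancellation of that M = m̄ in the last possible row m, when all m̄ are gone, and
-- from then on the tableau of u v is that of w with an additional m at the bottom of
-- the leftmost column without m.  In this second phase the cells of the growth diagram
-- obey the local rules of the m̄-stratum without (○), so the backward test climbs to
-- the cancellation and meets (○) there.  If instead M = m is plain, the same argument
-- applied to the runs of w and m w shows that the test reaches the left edge.

module Submission where

open import Defs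
open import Data.Bool using (Bool; true; false; if_then_else_; _∧_; _∨_; not)
open import Data.Bool.Properties using (T-≡; ∧-zeroʳ; ∨-zeroʳ)
open import Data.Empty using (⊥)
open import Data.List using (List; []; _∷_; _++_; length; map; concat; reverse; foldl; replicate; upTo; applyUpTo)
open import Data.List.Membership.Propositional using (_∈_)
open import Data.List.Membership.Propositional.Properties using (∈-++⁺ˡ; ∈-++⁺ʳ)
open import Data.List.Properties hiding (sum-++)
open import Data.List.Relation.Binary.Permutation.Propositional using (↭-sym)
open import Data.List.Relation.Binary.Permutation.Propositional.Properties using (All-resp-↭; ↭-reverse)
open import Data.List.Relation.Unary.All as All using (All; []; _∷_)
import Data.List.Relation.Unary.All.Properties as All
open import Data.List.Relation.Unary.Any using (here; there)
open import Data.Maybe using (Maybe; just; nothing)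
open import Data.Maybe.Properties using (just-injective)
open import Data.Nat
open import Data.Nat.ListAction using (sum)
open import Data.Nat.Properties
open import Data.Product using (∃; ∃₂; _×_; _,_; proj₁; proj₂)
open import Data.Sum using (_⊎_; inj₁; inj₂; [_,_]′)
open import Function using (_∘_; id; _$_; Equivalence)
open import Relation.Binary using (tri<; tri≈; tri>)
open import Relation.Binary.PropositionalEquality
open import Relation.Nullary using (¬_; Dec; yes; no)
open import Relation.Nullary.Negation using (contradiction)

-- The two runs can be compared because their tableaux share the part below M, or plain m in the
-- second phase: a smaller letter acts on that part once, and only the strips react differently. Of
-- this action a strip feels the row that changes, the letter that settles there and the tableau
-- just before it settles; these data survive the passage to the next larger letter, so one
-- induction over the alphabet covers Berele insertion. The symplectic condition enters at a single
-- point: an M pushed out of a row would break it exactly when M is the barred letter of that row,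
-- and then the bumping letter is its unbarred partner. The hypotheses of the five cases only tell
-- two outcomes apart. If M = m̄ is cancelled, row m was occupied, while letters up to m̄ never fill
-- more than m rows; hence l = m, row l loses a cell, and P keeps only letters up to l. If M
-- survives, it is the largest letter of P. The result of the test is determined in both situations
-- that (4) and (5) have to separate.

-- Functions of the row index: adding and removing a cell

inc dec : ℕ → (ℕ → ℕ) → ℕ → ℕ
inc zero    a zero    = suc (a zero)
inc zero    a (suc i) = a (suc i)
inc (suc k) a zero    = a zero
-- Recursion on the row instead of a test `i = k` makes `inc (suc k) a ∘ suc` compute to
-- `inc k (a ∘ suc)`, the form in which a strip is handed on to the next row.
inc (suc k) a (suc i) = inc k (a ∘ suc) i

dec zero    a zero    = pred (a zero)
dec zero    a (suc i) = a (suc i)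
dec (suc k) a zero    = a zero
dec (suc k) a (suc i) = dec k (a ∘ suc) i

inc-at : ∀ k a → inc k a k ≡ suc (a k)
inc-at zero    a = refl
inc-at (suc k) a = inc-at k (a ∘ suc)

inc-off : ∀ k a {i} → i ≢ k → inc k a i ≡ a i
inc-off zero    a {zero}  i≢k = contradiction refl i≢k
inc-off zero    a {suc i} i≢k = refl
inc-off (suc k) a {zero}  i≢k = refl
inc-off (suc k) a {suc i} i≢k = inc-off k (a ∘ suc) (i≢k ∘ cong suc)

dec-at : ∀ k a → dec k a k ≡ pred (a k)
dec-at zero    a = refl
dec-at (suc k) a = dec-at k (a ∘ suc)

dec-off : ∀ k a {i} → i ≢ k → dec k a i ≡ a i
dec-off zero    a {zero}  i≢k = contradiction refl i≢k
dec-off zero    a {suc i} i≢k = refl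
dec-off (suc k) a {zero}  i≢k = refl
dec-off (suc k) a {suc i} i≢k = dec-off k (a ∘ suc) (i≢k ∘ cong suc)

inc-cong : ∀ k {a b} → a ≗ b → inc k a ≗ inc k b
inc-cong zero    eq zero    = cong suc (eq zero)
inc-cong zero    eq (suc i) = eq (suc i)
inc-cong (suc k) eq zero    = eq zero
inc-cong (suc k) eq (suc i) = inc-cong k (eq ∘ suc) i

dec-cong : ∀ k {a b} → a ≗ b → dec k a ≗ dec k b
dec-cong zero    eq zero    = cong pred (eq zero)
dec-cong zero    eq (suc i) = eq (suc i)
dec-cong (suc k) eq zero    = eq zero
dec-cong (suc k) eq (suc i) = dec-cong k (eq ∘ suc) i

inc-comm : ∀ k r a → inc k (inc r a) ≗ inc r (inc k a)
inc-comm zero    zero    a i       = refl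
inc-comm zero    (suc r) a zero    = refl
inc-comm zero    (suc r) a (suc i) = refl
inc-comm (suc k) zero    a zero    = refl
inc-comm (suc k) zero    a (suc i) = refl
inc-comm (suc k) (suc r) a zero    = refl
inc-comm (suc k) (suc r) a (suc i) = inc-comm k r (a ∘ suc) i

dec-inc : ∀ k a → dec k (inc k a) ≗ a
dec-inc zero    a zero    = refl
dec-inc zero    a (suc i) = refl
dec-inc (suc k) a zero    = refl
dec-inc (suc k) a (suc i) = dec-inc k (a ∘ suc) i

inc-dec : ∀ k a → a k ≢ 0 → inc k (dec k a) ≗ a
inc-dec zero    a a≢0 zero with a zero
... | zero  = contradiction refl a≢0
... | suc _ = refl
inc-dec zero    a a≢0 (suc i) = refl
inc-dec (suc k) a a≢0 zero    = refl
inc-dec (suc k) a a≢0 (suc i) = inc-dec k (a ∘ suc) a≢0 i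

dec-inc-comm : ∀ k r a → a k ≢ 0 → dec k (inc r a) ≗ inc r (dec k a)
dec-inc-comm k r a a≢0 i = trans (dec-cong k (inc-cong r (λ j → sym (inc-dec k a a≢0 j))) i)
  (trans (dec-cong k (inc-comm r k (dec k a)) i) (dec-inc k _ i))

≤-inc : ∀ k a i → a i ≤ inc k a i
≤-inc zero    a zero    = n≤1+n _
≤-inc zero    a (suc i) = ≤-refl
≤-inc (suc k) a zero    = ≤-refl
≤-inc (suc k) a (suc i) = ≤-inc k (a ∘ suc) i

dec-≤ : ∀ k a i → dec k a i ≤ a i
dec-≤ zero    a zero    = pred[n]≤n
dec-≤ zero    a (suc i) = ≤-refl
dec-≤ (suc k) a zero    = ≤-refl
dec-≤ (suc k) a (suc i) = dec-≤ k (a ∘ suc) i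

-- Horizontal strips of a largest letter

len : Tab → ℕ → ℕ
len []      i       = 0
len (r ∷ S) zero    = length r
len (r ∷ S) (suc i) = len S i

data Proper : Tab → Set where
  []  : Proper []
  _∷_ : ∀ {r S} → r ≢ [] → Proper S → Proper (r ∷ S)

Below : ℕ → Tab → Set
Below c = All (All (λ y → code y < c))

-- ext M S a appends a i copies of M to row i of S; Fits is the condition that
-- they form a horizontal strip.
topRow : Letter → ℕ → Tab
topRow M zero    = []
topRow M (suc n) = replicate (suc n) M ∷ []

ext : Letter → Tab → (ℕ → ℕ) → Tab
ext M []      a = topRow M (a 0)
ext M (r ∷ S) a = (r ++ replicate (a 0) M) ∷ ext M S (a ∘ suc)

Fits : Tab → (ℕ → ℕ) → Set
Fits S a = ∀ i → len S (suc i) + a (suc i) ≤ len S i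

ext-cong : ∀ M S {a b} → a ≗ b → ext M S a ≡ ext M S b
ext-cong M []      eq = cong (topRow M) (eq 0)
ext-cong M (r ∷ S) eq = cong₂ _∷_ (cong (λ n → r ++ replicate n M) (eq 0)) (ext-cong M S (eq ∘ suc))

-- On the empty tableau `ext` reads only `a 0`. Nothing is lost, since a horizontal strip there
-- occupies a single row.
Fits[]⇒0 : ∀ {a} → Fits [] a → ∀ i → a (suc i) ≡ 0
Fits[]⇒0 fits i = n≤0⇒n≡0 (fits i)

Fits-tail : ∀ {r S a} → Fits (r ∷ S) a → Fits S (a ∘ suc)
Fits-tail fits i = fits (suc i)

Fits-mono : ∀ {S a b} → (∀ i → b i ≤ a i) → Fits S a → Fits S b
Fits-mono b≤a fits i = ≤-trans (+-monoʳ-≤ _ (b≤a (suc i))) (fits i)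

Fits-cong : ∀ {S S' a} → len S' ≗ len S → Fits S a → Fits S' a
Fits-cong {a = a} eq fits i = subst₂ (λ u v → u + a (suc i) ≤ v) (sym (eq (suc i))) (sym (eq i)) (fits i)

len-ext : ∀ M S a → Fits S a → ∀ i → len (ext M S a) i ≡ len S i + a i
len-ext M [] a fits i with a 0 in eq
len-ext M [] a fits zero    | zero  = sym eq
len-ext M [] a fits (suc i) | zero  = sym (Fits[]⇒0 {a} fits i)
len-ext M [] a fits zero    | suc n = trans (cong suc (length-replicate n)) (sym eq)
len-ext M [] a fits (suc i) | suc n = sym (Fits[]⇒0 {a} fits i)
len-ext M (r ∷ S) a fits zero    = trans (length-++ r) (cong (length r +_) (length-replicate (a 0)))
len-ext M (r ∷ S) a fits (suc i) = len-ext M S (a ∘ suc) (Fits-tail {r} {S} {a} fits) i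

proper-ext : ∀ M {S} a → Proper S → Proper (ext M S a)
proper-ext M a [] with a 0
... | zero  = []
... | suc _ = (λ ()) ∷ []
proper-ext M {r ∷ S} a (r≢[] ∷ p) = (r≢[] ∘ ++-conicalˡ r _) ∷ proper-ext M (a ∘ suc) p

below-ext : ∀ M {S} a → Below (code M) S → Below (suc (code M)) (ext M S a)
below-ext M a [] with a 0
... | zero  = []
... | suc n = All.replicate⁺ (suc n) ≤-refl ∷ []
below-ext M a (b ∷ bs) =
  All.++⁺ (All.map m<n⇒m<1+n b) (All.replicate⁺ (a 0) ≤-refl) ∷ below-ext M (a ∘ suc) bs

-- Supplies fuel for slides: after its moves inside S the hole makes either `a k` further moves
-- along the strip in its last row k, or one move down onto an M of row k + 1.
size-ext : ∀ M S a → Fits S a → ∀ i → size S + a i ≤ size (ext M S a)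
size-ext M [] a fits (suc i) = ≤-trans (≤-reflexive (Fits[]⇒0 {a} fits i)) z≤n
size-ext M [] a fits zero with a 0
... | zero  = z≤n
... | suc n rewrite length-replicate n {M} = ≤-trans (m≤m+n (suc n) 0) (m≤m+n _ 1)
size-ext M (r ∷ S) a fits i
  rewrite length-++ r {replicate (a 0) M} | length-replicate (a 0) {M} = go i
  where
  X = sum (map length (ext M S (a ∘ suc)))
  L = length (ext M S (a ∘ suc))
  rearr : ∀ p q s l → (p + q + s) + suc l ≡ suc ((s + l) + (p + q))
  rearr p q s l = begin
    (p + q + s) + suc l   ≡⟨ +-suc (p + q + s) l ⟩
    suc (p + q + s + l)   ≡⟨ cong suc (+-assoc (p + q) s l) ⟩
    suc (p + q + (s + l)) ≡⟨ cong suc (+-comm (p + q) (s + l)) ⟩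
    suc ((s + l) + (p + q)) ∎
    where open ≡-Reasoning
  rec : ∀ j → size S + a (suc j) ≤ X + L
  rec = size-ext M S (a ∘ suc) (Fits-tail {r} {S} {a} fits)
  lhs : length r + sum (map length S) + suc (length S) ≡ suc (size S + length r)
  lhs = begin
    length r + sum (map length S) + suc (length S)   ≡⟨ +-suc _ _ ⟩
    suc (length r + sum (map length S) + length S)   ≡⟨ cong suc (+-assoc (length r) _ _) ⟩
    suc (length r + size S)                          ≡⟨ cong suc (+-comm (length r) _) ⟩
    suc (size S + length r) ∎
    where open ≡-Reasoning
  open ≤-Reasoning
  go : ∀ i → length r + sum (map length S) + suc (length S) + a i ≤ length r + a 0 + X + suc L
  go zero = begin
    length r + sum (map length S) + suc (length S) + a 0 ≡⟨ cong (_+ a 0) lhs ⟩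
    suc (size S + length r + a 0)   ≡⟨ cong suc (+-assoc (size S) _ _) ⟩
    suc (size S + (length r + a 0)) ≤⟨ s≤s (+-monoˡ-≤ (length r + a 0) (≤-trans (m≤m+n (size S) (a 1)) (rec 0))) ⟩
    suc ((X + L) + (length r + a 0)) ≡⟨ sym (rearr (length r) (a 0) X L) ⟩
    length r + a 0 + X + suc L ∎
  go (suc i) = begin
    length r + sum (map length S) + suc (length S) + a (suc i) ≡⟨ cong (_+ a (suc i)) lhs ⟩
    suc (size S + length r + a (suc i))   ≡⟨ cong suc (+-assoc (size S) _ _) ⟩
    suc (size S + (length r + a (suc i))) ≡⟨ cong (λ z → suc (size S + z)) (+-comm (length r) _) ⟩
    suc (size S + (a (suc i) + length r)) ≡⟨ cong suc (sym (+-assoc (size S) _ _)) ⟩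
    suc ((size S + a (suc i)) + length r) ≤⟨ s≤s (+-mono-≤ (rec i) (m≤m+n _ _)) ⟩
    suc ((X + L) + (length r + a 0)) ≡⟨ sym (rearr (length r) (a 0) X L) ⟩
    length r + a 0 + X + suc L ∎

-- Row insertion

<L-true : ∀ x y → code x < code y → (x <L y) ≡ true
<L-true x y lt = Equivalence.to T-≡ (<⇒<ᵇ lt)

<L-false : ∀ x y → code y ≤ code x → (x <L y) ≡ false
<L-false x y le with code x <ᵇ code y in eq
... | false = refl
... | true  = contradiction (<ᵇ⇒< _ _ (Equivalence.from T-≡ eq)) (≤⇒≯ le)

≤L-true : ∀ x y → code x ≤ code y → (x ≤L y) ≡ true
≤L-true x y le = Equivalence.to T-≡ (≤⇒≤ᵇ le)

≤L-false : ∀ x y → code y < code x → (x ≤L y) ≡ false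
≤L-false x y lt with code x ≤ᵇ code y in eq
... | false = refl
... | true  = contradiction (≤ᵇ⇒≤ _ _ (Equivalence.from T-≡ eq)) (<⇒≱ lt)

bump-++ : ∀ x r s {j y} → bump x r ≡ just (j , y) → bump x (r ++ s) ≡ just (j , y)
bump-++ x (z ∷ r) s eq with x <L z
... | true = eq
... | false with bump x r in eq'
...   | just _ rewrite bump-++ x r s eq' = eq

bump-replicate : ∀ x M r n → code x < code M → bump x r ≡ nothing →
  bump x (r ++ replicate (suc n) M) ≡ just (length r , M)
bump-replicate x M [] n x<M eq rewrite <L-true x M x<M = refl
bump-replicate x M (z ∷ r) n x<M eq with x <L z
... | false with bump x r in eq'
...   | nothing rewrite bump-replicate x M r n x<M eq' = refl

bump-none : ∀ x {r} → All (λ y → code y ≤ code x) r → bump x r ≡ nothing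
bump-none x [] = refl
bump-none x {z ∷ r} (p ∷ ps) rewrite <L-false x z p | bump-none x ps = refl

bump-< : ∀ x r {j y} → bump x r ≡ just (j , y) → j < length r
bump-< x (z ∷ r) eq with x <L z
bump-< x (z ∷ r) refl | true = z<s
... | false with bump x r in eq'
bump-< x (z ∷ r) refl | false | just (j , y) = s<s (bump-< x r eq')

bump-All : ∀ {P : Letter → Set} x r {j y} → bump x r ≡ just (j , y) → All P r → P y
bump-All x (z ∷ r) eq (p ∷ ps) with x <L z
bump-All x (z ∷ r) refl (p ∷ ps) | true = p
... | false with bump x r in eq'
bump-All x (z ∷ r) refl (p ∷ ps) | false | just (j , y) = bump-All x r eq' ps

setAt-++ : ∀ {A : Set} (r s : List A) {j} x → j < length r → setAt (r ++ s) j x ≡ setAt r j x ++ s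
setAt-++ (z ∷ r) s {zero}  x lt = refl
setAt-++ (z ∷ r) s {suc j} x (s<s lt) = cong (z ∷_) (setAt-++ r s x lt)

setAt-length : ∀ {A : Set} (r : List A) z s x → setAt (r ++ z ∷ s) (length r) x ≡ r ++ x ∷ s
setAt-length []      z s x = refl
setAt-length (y ∷ r) z s x = cong (y ∷_) (setAt-length r z s x)

-- Ins i x S k y R S' : the insertion of x into S ends by placing y at the end of
-- row k; R is the tableau just before y is placed.
data Ins : ℕ → Letter → Tab → ℕ → Letter → Tab → Tab → Set where
  new : ∀ {i x} → Ins i x [] 0 x [] ((x ∷ []) ∷ [])
  app : ∀ {i x r rs} → bump x r ≡ nothing → Ins i x (r ∷ rs) 0 x (r ∷ rs) ((r ++ x ∷ []) ∷ rs)
  bmp : ∀ {i x r rs j y k z R S'} → bump x r ≡ just (j , y) → isCancel i x y ≡ false →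
        Ins (suc i) y rs k z R S' → Ins i x (r ∷ rs) (suc k) z (setAt r j x ∷ R) (setAt r j x ∷ S')

-- The barred letter stays stored in the hole, because `slide` overwrites or deletes that entry
-- anyway.
data Can : ℕ → Letter → Tab → ℕ → ℕ → Tab → Set where
  here  : ∀ {i x r rs j y} → bump x r ≡ just (j , y) → isCancel i x y ≡ true →
          Can i x (r ∷ rs) 0 j (r ∷ rs)
  there : ∀ {i x r rs j y p q S'} → bump x r ≡ just (j , y) → isCancel i x y ≡ false →
          Can (suc i) y rs p q S' → Can i x (r ∷ rs) (suc p) q (setAt r j x ∷ S')

Ins⇒insGo : ∀ {i x S k y R S'} → Ins i x S k y R S' → insGo i x S ≡ done S'
Ins⇒insGo new = refl
Ins⇒insGo (app eq) rewrite eq = refl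
Ins⇒insGo (bmp eq c ins) rewrite eq | c | Ins⇒insGo ins = refl

Can⇒insGo : ∀ {i x S p q S'} → Can i x S p q S' → insGo i x S ≡ hole p q S'
Can⇒insGo (here eq c) rewrite eq | c = refl
Can⇒insGo (there eq c can) rewrite eq | c | Can⇒insGo can = refl

module _ (M : Letter) where

  replicate-∷ʳ : ∀ n → replicate n M ++ M ∷ [] ≡ replicate (suc n) M
  replicate-∷ʳ zero    = refl
  replicate-∷ʳ (suc n) = cong (M ∷_) (replicate-∷ʳ n)

  Ins-max : ∀ i S a → Fits S a → Below (suc (code M)) S →
    Ins i M (ext M S a) 0 M (ext M S a) (ext M S (inc 0 a))
  Ins-max i [] a fits [] with a 0
  ... | zero  = new
  ... | suc n = subst (λ r → Ins i M (topRow M (suc n)) 0 M (topRow M (suc n)) (r ∷ []))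
                  (replicate-∷ʳ (suc n))
                  (app (bump-none M {replicate (suc n) M} (All.replicate⁺ {x = M} (suc n) ≤-refl)))
  Ins-max i (r ∷ S) a fits (b ∷ bs) =
    subst (λ s → Ins i M (ext M (r ∷ S) a) 0 M (ext M (r ∷ S) a) (s ∷ ext M S (a ∘ suc)))
      (trans (++-assoc r _ _) (cong (r ++_) (replicate-∷ʳ (a 0))))
      (app (bump-none M (All.++⁺ (All.map s≤s⁻¹ b) (All.replicate⁺ {x = M} (a 0) ≤-refl))))

  Ins-free : ∀ {i x S k y R S'} a → Fits S a → a k ≡ 0 → Ins i x S k y R S' →
    Ins i x (ext M S a) k y (ext M R a) (ext M S' a)
  Ins-free a fits a≡0 (new {x = x}) rewrite a≡0 | Fits[]⇒0 {a} fits 0 = new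
  Ins-free a fits a≡0 (app {x = x} {r = r} eq)
    rewrite a≡0 | ++-identityʳ r | ++-identityʳ (r ++ x ∷ []) = app eq
  Ins-free {S = r ∷ S} a fits a≡0 (bmp {x = x} eq c ins)
    rewrite sym (setAt-++ r (replicate (a 0) M) x (bump-< x r eq)) =
    bmp (bump-++ x r _ eq) c (Ins-free (a ∘ suc) (Fits-tail {r} {S} {a} fits) a≡0 ins)

  -- In S the letter y goes to the end of row k, where the extended tableau has its first M. That M
  -- is bumped and, being largest, is appended to row k + 1; `dec k a` is the moment between.
  Ins-bump : ∀ {i x S k y R S'} a {n} → Fits S a → Below (code M) S → code x < code M → a k ≡ suc n →
    isCancel (i + k) y M ≡ false → Ins i x S k y R S' →
    Ins i x (ext M S a) (suc k) M (ext M S' (dec k a)) (ext M S' (inc (suc k) (dec k a)))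
  Ins-bump {i} a {n} fits b x<M a≡ c (new {x = x})
    rewrite a≡ | Fits[]⇒0 {a} fits 0 | +-identityʳ i =
    bmp (bump-replicate x M [] n x<M refl) c new
  Ins-bump {i} a {n} fits (b ∷ bs) x<M a≡ c (app {x = x} {r = r} {rs} eq)
    rewrite a≡ | +-identityʳ i | ++-assoc r (x ∷ []) (replicate n M) =
    subst (λ s → Ins i x _ 1 M (s ∷ _) (s ∷ _)) (setAt-length r M _ x)
      (bmp (bump-replicate x M r n x<M eq) c
        (Ins-max (suc i) rs (a ∘ suc) (Fits-tail {r} {rs} {a} fits) (All.map (All.map m<n⇒m<1+n) bs)))
  Ins-bump {i} {S = r ∷ S} {suc k} a fits (b ∷ bs) x<M a≡ c (bmp {x = x} eq c' ins)
    rewrite sym (setAt-++ r (replicate (a 0) M) x (bump-< x r eq)) | +-suc i k =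
    bmp (bump-++ x r _ eq) c'
      (Ins-bump (a ∘ suc) (Fits-tail {r} {S} {a} fits) bs (bump-All x r eq b) a≡ c ins)

  -- Here y meets its barred partner at the first M of row k. It is never placed, so what remains
  -- below the strip is R and not S'.
  Ins-cancel : ∀ {i x S k y R S'} a {n} → Fits S a → Below (code M) S → code x < code M → a k ≡ suc n →
    isCancel (i + k) y M ≡ true → Ins i x S k y R S' →
    Can i x (ext M S a) k (len S k) (ext M R a)
  Ins-cancel {i} a {n} fits b x<M a≡ c (new {x = x})
    rewrite a≡ | +-identityʳ i = here (bump-replicate x M [] n x<M refl) c
  Ins-cancel {i} a {n} fits (b ∷ bs) x<M a≡ c (app {x = x} {r = r} {rs} eq)
    rewrite a≡ | +-identityʳ i = here (bump-replicate x M r n x<M eq) c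
  Ins-cancel {i} {S = r ∷ S} {suc k} a fits (b ∷ bs) x<M a≡ c (bmp {x = x} eq c' ins)
    rewrite sym (setAt-++ r (replicate (a 0) M) x (bump-< x r eq)) | +-suc i k =
    there (bump-++ x r _ eq) c'
      (Ins-cancel (a ∘ suc) (Fits-tail {r} {S} {a} fits) bs (bump-All x r eq b) a≡ c ins)

  Can-ext : ∀ {i x S p q S'} a → Can i x S p q S' → Can i x (ext M S a) p q (ext M S' a)
  Can-ext a (here {x = x} {r = r} eq c) = here (bump-++ x r _ eq) c
  Can-ext a (there {x = x} {r = r} eq c can)
    rewrite sym (setAt-++ r (replicate (a 0) M) x (bump-< x r eq)) =
    there (bump-++ x r _ eq) c (Can-ext (a ∘ suc) can)

-- Jeu de taquin

nth-< : ∀ {A : Set} (r : List A) j {b} → nth r j ≡ just b → j < length r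
nth-< (x ∷ r) zero    eq = z<s
nth-< (x ∷ r) (suc j) eq = s<s (nth-< r j eq)

nth-≥ : ∀ {A : Set} (r : List A) j → nth r j ≡ nothing → length r ≤ j
nth-≥ []      j       eq = z≤n
nth-≥ (x ∷ r) (suc j) eq = s≤s (nth-≥ r j eq)

≥-nth : ∀ {A : Set} (r : List A) j → length r ≤ j → nth r j ≡ nothing
≥-nth []      j       le       = refl
≥-nth (x ∷ r) (suc j) (s≤s le) = ≥-nth r j le

nth-++ : ∀ {A : Set} (r s : List A) j {b} → nth r j ≡ just b → nth (r ++ s) j ≡ just b
nth-++ (x ∷ r) s zero    eq = eq
nth-++ (x ∷ r) s (suc j) eq = nth-++ r s j eq

nth-length : ∀ {A : Set} (p : List A) z s → nth (p ++ z ∷ s) (length p) ≡ just z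
nth-length []      z s = refl
nth-length (x ∷ p) z s = nth-length p z s

nth-suc-length : ∀ {A : Set} (p : List A) z s → nth (p ++ z ∷ s) (suc (length p)) ≡ nth s 0
nth-suc-length []      z s = refl
nth-suc-length (x ∷ p) z s = nth-suc-length p z s

nth-All : ∀ {A : Set} {P : A → Set} (r : List A) j {b} → nth r j ≡ just b → All P r → P b
nth-All (x ∷ r) zero    refl (p ∷ ps) = p
nth-All (x ∷ r) (suc j) eq   (p ∷ ps) = nth-All r j eq ps

nth-++-replicate : ∀ (r : List Letter) n M j {b} → nth (r ++ replicate n M) j ≡ just b → nth r j ≡ just b ⊎ b ≡ M
nth-++-replicate []      (suc n) M zero    refl = inj₂ refl
nth-++-replicate []      (suc n) M (suc j) eq with nth-++-replicate [] n M j eq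
... | inj₂ b≡M = inj₂ b≡M
nth-++-replicate (x ∷ r) n       M zero    eq = inj₁ eq
nth-++-replicate (x ∷ r) n       M (suc j) eq = nth-++-replicate r n M j eq

nth-replicate : ∀ {A : Set} n (M : A) j → j < n → nth (replicate n M) j ≡ just M
nth-replicate (suc n) M zero    lt       = refl
nth-replicate (suc n) M (suc j) (s<s lt) = nth-replicate n M j lt

nth-++ʳ : ∀ {A : Set} (r s : List A) j → nth (r ++ s) (length r + j) ≡ nth s j
nth-++ʳ []      s j = refl
nth-++ʳ (x ∷ r) s j = nth-++ʳ r s j

get-< : ∀ T i j {b} → get T i j ≡ just b → j < len T i
get-< (r ∷ T) zero    j eq = nth-< r j eq
get-< (r ∷ T) (suc i) j eq = get-< T i j eq

get-≥ : ∀ T i j → get T i j ≡ nothing → len T i ≤ j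
get-≥ []      i       j eq = z≤n
get-≥ (r ∷ T) zero    j eq = nth-≥ r j eq
get-≥ (r ∷ T) (suc i) j eq = get-≥ T i j eq

≥-get : ∀ T i j → len T i ≤ j → get T i j ≡ nothing
≥-get []      i       j le = refl
≥-get (r ∷ T) zero    j le = ≥-nth r j le
≥-get (r ∷ T) (suc i) j le = ≥-get T i j le

get-below : ∀ {c} T i j {b} → get T i j ≡ just b → Below c T → code b < c
get-below (r ∷ T) zero    j eq (p ∷ ps) = nth-All r j eq p
get-below (r ∷ T) (suc i) j eq (p ∷ ps) = get-below T i j eq ps

length-setAt : ∀ {A : Set} (r : List A) j b → length (setAt r j b) ≡ length r
length-setAt []      j       b = refl
length-setAt (x ∷ r) zero    b = refl
length-setAt (x ∷ r) (suc j) b = cong suc (length-setAt r j b)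

setAt-All : ∀ {A : Set} {P : A → Set} (r : List A) j {b} → P b → All P r → All P (setAt r j b)
setAt-All []      j       pb []       = []
setAt-All (x ∷ r) zero    pb (p ∷ ps) = pb ∷ ps
setAt-All (x ∷ r) (suc j) pb (p ∷ ps) = p ∷ setAt-All r j pb ps

setAt-≢[] : ∀ {A : Set} (r : List A) j {b} → r ≢ [] → setAt r j b ≢ []
setAt-≢[] []      j       r≢[] eq = r≢[] refl
setAt-≢[] (x ∷ r) zero    r≢[] ()
setAt-≢[] (x ∷ r) (suc j) r≢[] ()

len-set : ∀ T i j b → len (set T i j b) ≗ len T
len-set []      i       j b k       = refl
len-set (r ∷ T) zero    j b zero    = length-setAt r j b
len-set (r ∷ T) zero    j b (suc k) = refl
len-set (r ∷ T) (suc i) j b zero    = refl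
len-set (r ∷ T) (suc i) j b (suc k) = len-set T i j b k

below-set : ∀ {c} T i j {b} → code b < c → Below c T → Below c (set T i j b)
below-set []      i       j lt []       = []
below-set (r ∷ T) zero    j lt (p ∷ ps) = setAt-All r j lt p ∷ ps
below-set (r ∷ T) (suc i) j lt (p ∷ ps) = p ∷ below-set T i j lt ps

proper-set : ∀ {T} i j b → Proper T → Proper (set T i j b)
proper-set         i       j b []       = []
proper-set {r ∷ _} zero    j b (p ∷ ps) = setAt-≢[] r j p ∷ ps
proper-set         (suc i) j b (p ∷ ps) = p ∷ proper-set i j b ps

module _ (M : Letter) where

  get-ext : ∀ S a i j {b} → get (ext M S a) i j ≡ just b → get S i j ≡ just b ⊎ b ≡ M
  get-ext [] a i j eq with a 0
  get-ext [] a zero j eq | suc n = nth-++-replicate [] (suc n) M j eq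
  get-ext (r ∷ S) a zero    j eq = nth-++-replicate r (a 0) M j eq
  get-ext (r ∷ S) a (suc i) j eq = get-ext S (a ∘ suc) i j eq

  ext-get : ∀ S a i j {b} → get S i j ≡ just b → get (ext M S a) i j ≡ just b
  ext-get (r ∷ S) a zero    j eq = nth-++ r _ j eq
  ext-get (r ∷ S) a (suc i) j eq = ext-get S (a ∘ suc) i j eq

  get-ext-M : ∀ S a i j → Fits S a → len S i ≤ j → j < len S i + a i → get (ext M S a) i j ≡ just M
  get-ext-M [] a zero j fits le lt with a 0
  ... | suc n = nth-replicate (suc n) M j lt
  get-ext-M [] a (suc i) j fits le lt rewrite Fits[]⇒0 {a} fits i = contradiction lt λ ()
  get-ext-M (r ∷ S) a zero j fits le lt with m≤n⇒∃[o]m+o≡n le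
  ... | c , refl = trans (nth-++ʳ r _ c) (nth-replicate (a 0) M c (+-cancelˡ-< (length r) c (a 0) lt))
  get-ext-M (r ∷ S) a (suc i) j fits le lt = get-ext-M S (a ∘ suc) i j (Fits-tail {r} {S} {a} fits) le lt

  set-ext : ∀ S a i j b → j < len S i → set (ext M S a) i j b ≡ ext M (set S i j b) a
  set-ext (r ∷ S) a zero    j b lt = cong (_∷ _) (setAt-++ r _ b lt)
  set-ext (r ∷ S) a (suc i) j b lt = cong (_ ∷_) (set-ext S (a ∘ suc) i j b lt)

-- Slides n T i j k T' : sliding the hole at (i , j) takes n moves and vacates the
-- last cell of row k.
data Slides : ℕ → Tab → ℕ → ℕ → ℕ → Tab → Set where
  stop  : ∀ {T i j} → get T (suc i) j ≡ nothing → get T i (suc j) ≡ nothing →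
          Slides 0 T i j i (deleteCell T i j)
  goDown  : ∀ {n T i j k T' b} → get T (suc i) j ≡ just b →
          (∀ r → get T i (suc j) ≡ just r → code b ≤ code r) →
          Slides n (set T i j b) (suc i) j k T' → Slides (suc n) T i j k T'
  goRight : ∀ {n T i j k T' r} → get T i (suc j) ≡ just r →
          (∀ b → get T (suc i) j ≡ just b → code r < code b) →
          Slides n (set T i j r) i (suc j) k T' → Slides (suc n) T i j k T'

slide-correct : ∀ {n T i j k T'} f → Slides n T i j k T' → n ≤ f → slide f T i j ≡ T'
slide-correct zero (stop below right) le = refl
slide-correct (suc f) (stop below right) le rewrite below | right = refl
slide-correct (suc f) (goDown {T = T} {i} {j} {b = b} below right sl) (s≤s le) with get T (suc i) j | get T i (suc j)
slide-correct (suc f) (goDown refl right sl) (s≤s le) | .(just _) | nothing = slide-correct f sl le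
slide-correct (suc f) (goDown {b = b} refl right sl) (s≤s le) | .(just _) | just r
  rewrite ≤L-true b r (right r refl) = slide-correct f sl le
slide-correct (suc f) (goRight {T = T} {i} {j} right' below sl) (s≤s le) with get T (suc i) j | get T i (suc j)
slide-correct (suc f) (goRight refl below sl) (s≤s le) | nothing | .(just _) = slide-correct f sl le
slide-correct (suc f) (goRight {r = r} refl below sl) (s≤s le) | just b | .(just _)
  rewrite ≤L-false b r (below b refl) = slide-correct f sl le

Slides-∷ : ∀ {n T i j k T' r} → r ≢ [] → Slides n T i j k T' → Slides n (r ∷ T) (suc i) j (suc k) (r ∷ T')
Slides-∷ {T = T} {i} {j} {k} {r = []} r≢[] sl = contradiction refl r≢[]
Slides-∷ {T = T} {i} {j} {k} {r = x ∷ r} r≢[] (stop below right) = stop below right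
Slides-∷ {r = x ∷ r} r≢[] (goDown below right sl) = goDown below right (Slides-∷ r≢[] sl)
Slides-∷ {r = x ∷ r} r≢[] (goRight right' below sl) = goRight right' below (Slides-∷ r≢[] sl)

removeAt-length : ∀ {A : Set} (p : List A) z s → removeAt (p ++ z ∷ s) (length p) ≡ p ++ s
removeAt-length []      z s = refl
removeAt-length (x ∷ p) z s = cong (x ∷_) (removeAt-length p z s)

removeAt-++ʳ : ∀ {A : Set} (r s : List A) j → removeAt (r ++ s) (length r + j) ≡ r ++ removeAt s j
removeAt-++ʳ []      s j = refl
removeAt-++ʳ (x ∷ r) s j = cong (x ∷_) (removeAt-++ʳ r s j)

snoc-view : ∀ {A : Set} (r : List A) j → j < length r → length r ≤ suc j →
  ∃₂ λ p z → r ≡ p ++ z ∷ [] × length p ≡ j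
snoc-view (x ∷ [])    zero    lt le = [] , x , refl , refl
snoc-view (x ∷ y ∷ r) zero    lt (s≤s ())
snoc-view (x ∷ r)     (suc j) (s<s lt) (s≤s le) with snoc-view r j lt le
... | p , z , refl , refl = x ∷ p , z , refl , refl

dropEmpty-proper : ∀ {T} → Proper T → dropEmpty T ≡ T
dropEmpty-proper [] = refl
dropEmpty-proper {[] ∷ T}      (p ∷ ps) = contradiction refl p
dropEmpty-proper {(x ∷ r) ∷ T} (p ∷ ps) = cong ((x ∷ r) ∷_) (dropEmpty-proper ps)

Proper-head0 : ∀ {T} → Proper T → len T 0 ≤ 0 → T ≡ []
Proper-head0 [] le = refl
Proper-head0 {[] ∷ T} (p ∷ ps) le = contradiction refl p

module _ (M : Letter) where

  -- The next row ends no later than the column left of the hole, so nothing is ever below the hole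
  -- and it can only pass through the c copies of M.
  run-right : ∀ T p z c → len T 0 ≤ length p →
    Slides c ((p ++ z ∷ replicate c M) ∷ T) 0 (length p) 0 (dropEmpty ((p ++ replicate c M) ∷ T))
  run-right T p z zero le =
    subst (λ r → Slides 0 ((p ++ z ∷ []) ∷ T) 0 (length p) 0 (dropEmpty (r ∷ T))) (removeAt-length p z [])
      (stop (≥-get T 0 (length p) le) (nth-suc-length p z []))
  run-right T p z (suc c) le =
    goRight (nth-suc-length p z (replicate (suc c) M))
      (λ b eq → contradiction (get-< T 0 (length p) eq) (≤⇒≯ le))
      (subst (λ r → Slides c (r ∷ T) 0 (suc (length p)) 0 _)
         (trans (++-assoc p (M ∷ []) _) (sym (setAt-length p z (replicate (suc c) M) M)))
        (subst₂ (λ j r → Slides c (((p ++ M ∷ []) ++ M ∷ replicate c M) ∷ T) 0 j 0 (dropEmpty (r ∷ T)))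
          len+1 (++-assoc p (M ∷ []) (replicate c M))
          (run-right T (p ++ M ∷ []) M c (≤-trans le (≤-trans (n≤1+n _) (≤-reflexive (sym len+1)))))))
    where
    len+1 : length (p ++ M ∷ []) ≡ suc (length p)
    len+1 = trans (length-++ p) (+-comm (length p) 1)

  removeAt-replicate : ∀ n → removeAt (replicate (suc n) M) n ≡ replicate n M
  removeAt-replicate zero    = refl
  removeAt-replicate (suc n) = cong (M ∷_) (removeAt-replicate n)

  deleteCell-ext : ∀ {S} a i j → Proper S → Fits S a → len S i ≤ j → suc j ≡ len S i + a i →
    deleteCell (ext M S a) i j ≡ ext M S (dec i a)
  deleteCell-ext {[]} a zero j ps fits le eq with a 0
  deleteCell-ext {[]} a zero j ps fits le refl | suc n rewrite removeAt-replicate n with n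
  ... | zero  = refl
  ... | suc _ = refl
  deleteCell-ext {[]} a (suc i) j ps fits le eq rewrite Fits[]⇒0 {a} fits i = contradiction eq λ ()
  deleteCell-ext {[] ∷ S} a i j (p ∷ ps) fits le eq = contradiction refl p
  deleteCell-ext {(x ∷ r) ∷ S} a (suc i) j (p ∷ ps) fits le eq =
    cong (_ ∷_) (deleteCell-ext (a ∘ suc) i j ps (Fits-tail {_} {S} {a} fits) le eq)
  deleteCell-ext {(x ∷ r) ∷ S} a zero j (p ∷ ps) fits le eq with m≤n⇒∃[o]m+o≡n le
  ... | c , refl with a 0 | +-cancelˡ-≡ (length (x ∷ r)) (suc c) (a 0) (trans (+-suc _ c) eq)
  ... | .(suc c) | refl rewrite removeAt-++ʳ r (replicate (suc c) M) c | removeAt-replicate c =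
    cong (_ ∷_) (dropEmpty-proper (proper-ext M (a ∘ suc) ps))

  -- The hole has reached the last cell of row i of S, and row i + 1 with its strip stops to the
  -- left of it; only the copies of M in the same row can still move.
  stop-free : ∀ {S} a i j → Proper S → Fits S a → j < len S i → len S i ≤ suc j → len S (suc i) ≤ j →
    len S (suc i) + a (suc i) < len S i →
    Slides (a i) (ext M S a) i j i (ext M (deleteCell S i j) a)
  stop-free {[] ∷ S} a i j (p ∷ ps) fits j< ≤j below free = contradiction refl p
  stop-free {(x ∷ r) ∷ S} a (suc i) j (p ∷ ps) fits j< ≤j below free =
    Slides-∷ (λ ()) (stop-free (a ∘ suc) i j ps (Fits-tail {_} {S} {a} fits) j< ≤j below free)
  stop-free {r ∷ S} a zero j (p ∷ ps) fits j< ≤j below free with snoc-view r j j< ≤j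
  ... | q , z , refl , refl
    rewrite removeAt-length q z [] | ++-identityʳ q | ++-assoc q (z ∷ []) (replicate (a 0) M) =
    subst (Slides _ _ _ _ _) (result q S refl)
      (run-right (ext M S (a ∘ suc)) q z (a 0)
        (≤-trans (≤-reflexive (len-ext M S (a ∘ suc) (Fits-tail {_} {S} {a} fits) 0)) (s≤s⁻¹ (≤-trans free ≤j'))))
    where
    ≤j' : length (q ++ z ∷ []) ≤ suc (length q)
    ≤j' = ≤j
    result : ∀ q' S' → (q' , S') ≡ (q , S) → dropEmpty ((q' ++ replicate (a 0) M) ∷ ext M S' (a ∘ suc)) ≡ ext M (dropEmpty (q' ∷ S')) a
    result (y ∷ q') S' refl =
      cong ((y ∷ q' ++ replicate (a 0) M) ∷_)
        (trans (dropEmpty-proper (proper-ext M (a ∘ suc) ps)) (cong (λ X → ext M X (a ∘ suc)) (sym (dropEmpty-proper ps))))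
    -- The row of S disappears, so it was the last one of S. The copies of M that remain, if any,
    -- become the first row of an extension of `[]`.
    result [] S' refl with Proper-head0 ps below
    ... | refl with n≤0⇒n≡0 (s≤s⁻¹ free)
    ... | a1≡0 rewrite a1≡0 with a 0
    ... | zero  = refl
    ... | suc n = refl

  -- An M lies just below the hole, and a tie with an M on the right is resolved downwards. This M
  -- ends its row, and the strip is horizontal, so nothing lies to the right of it or below it and
  -- the hole stops after one move.
  stop-jump : ∀ {S} a i j → Proper S → Fits S a → j < len S i → len S i ≤ suc j → len S (suc i) ≤ j →
    len S (suc i) + a (suc i) ≡ len S i →
    Slides 1 (ext M S a) i j (suc i) (ext M (deleteCell S i j) (inc i (dec (suc i) a)))
  stop-jump {[] ∷ S} a i j (p ∷ ps) fits j< ≤j below jump = contradiction refl p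
  stop-jump {(x ∷ r) ∷ S} a (suc i) j (p ∷ ps) fits j< ≤j below jump =
    Slides-∷ (λ ()) (stop-jump (a ∘ suc) i j ps (Fits-tail {_} {S} {a} fits) j< ≤j below jump)
  stop-jump {r ∷ S} a zero j (p ∷ ps) fits j< ≤j below jump with snoc-view r j j< ≤j
  ... | q , z , refl , refl
    rewrite removeAt-length q z [] | ++-identityʳ q | ++-assoc q (z ∷ []) (replicate (a 0) M) =
    goDown (get-ext-M M S (a ∘ suc) 0 (length q) fits' below row1>)
      (λ r eq → right-M r (trans (sym (nth-suc-length q z (replicate (a 0) M))) eq))
      (subst₂ (λ r X → Slides 0 (r ∷ ext M S (a ∘ suc)) 1 (length q) 1 X)
        (sym (setAt-length q z (replicate (a 0) M) M))
        (trans (cong (_ ∷_) (deleteCell-ext (a ∘ suc) 0 (length q) ps fits' below row1)) (result q S refl))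
        (Slides-∷ (λ eq → contradiction (++-conicalʳ q _ eq) λ ())
          (stop (≥-get X 1 (length q) row2) (≥-get X 0 (suc (length q)) (≤-reflexive (trans (len-ext M S (a ∘ suc) fits' 0) (sym row1)))))))
    where
    X = ext M S (a ∘ suc)
    fits' = Fits-tail {q ++ z ∷ []} {S} {a} fits
    row1 : suc (length q) ≡ len S 0 + a 1
    row1 = trans (sym (trans (length-++ q) (+-comm (length q) 1))) (sym jump)
    row1> : length q < len S 0 + a 1
    row1> = ≤-reflexive row1
    row2 : len X 1 ≤ length q
    row2 = ≤-trans (≤-reflexive (len-ext M S (a ∘ suc) fits' 1)) (≤-trans (fits' 0) below)
    right-M : ∀ r → nth (replicate (a 0) M) 0 ≡ just r → code M ≤ code r
    right-M r eq with a 0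
    right-M r refl | suc _ = ≤-refl
    result : ∀ q' S' → (q' , S') ≡ (q , S) →
      (q' ++ M ∷ replicate (a 0) M) ∷ ext M S' (dec 0 (a ∘ suc)) ≡ ext M (dropEmpty (q' ∷ S')) (inc 0 (dec 1 a))
    result (y ∷ q') S' refl = cong (λ Y → _ ∷ ext M Y (dec 0 (a ∘ suc))) (sym (dropEmpty-proper ps))
    result [] S' refl with Proper-head0 ps below
    ... | refl rewrite sym row1 = refl

  -- A copy of M loses every comparison with a letter of S, so the hole follows its old path up to
  -- the end of row k. Both continuations are proved together because k is known only at the end of
  -- the path.
  Slides-ext : ∀ {n S i j k S'} a → Proper S → Below (code M) S → Fits S a → j < len S i → Slides n S i j k S' →
    (len S (suc k) + a (suc k) < len S k → Slides (n + a k) (ext M S a) i j k (ext M S' a)) ×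
    (len S (suc k) + a (suc k) ≡ len S k →
       Slides (n + 1) (ext M S a) i j (suc k) (ext M S' (inc k (dec (suc k) a))))
  Slides-ext {S = S} {i} {j} a ps bs fits j< (stop below right) =
    stop-free a i j ps fits j< (get-≥ S i (suc j) right) (get-≥ S (suc i) j below) ,
    stop-jump a i j ps fits j< (get-≥ S i (suc j) right) (get-≥ S (suc i) j below)
  Slides-ext {S = S} {i} {j} {k} a ps bs fits j< (goDown {b = b} below right sl)
    with Slides-ext a (proper-set i j b ps) (below-set S i j (get-below S (suc i) j below bs) bs)
           (Fits-cong {S} {set S i j b} {a} (len-set S i j b) fits)
           (<-≤-trans (get-< S (suc i) j below) (≤-reflexive (sym (len-set S i j b (suc i))))) sl
  ... | free , jump rewrite len-set S i j b k | len-set S i j b (suc k) | sym (set-ext M S a i j b j<) =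
    (λ p → goDown below' right' (free p)) , (λ p → goDown below' right' (jump p))
    where
    below' = ext-get M S a (suc i) j below
    right' : ∀ r → get (ext M S a) i (suc j) ≡ just r → code b ≤ code r
    right' r eq with get-ext M S a i (suc j) eq
    ... | inj₁ eq'  = right r eq'
    ... | inj₂ refl = <⇒≤ (get-below S (suc i) j below bs)
  Slides-ext {S = S} {i} {j} {k} a ps bs fits j< (goRight {r = r} right' below sl)
    with Slides-ext a (proper-set i j r ps) (below-set S i j (get-below S i (suc j) right' bs) bs)
           (Fits-cong {S} {set S i j r} {a} (len-set S i j r) fits)
           (<-≤-trans (get-< S i (suc j) right') (≤-reflexive (sym (len-set S i j r i)))) sl
  ... | free , jump rewrite len-set S i j r k | len-set S i j r (suc k) | sym (set-ext M S a i j r j<) =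
    (λ p → goRight right″ below' (free p)) , (λ p → goRight right″ below' (jump p))
    where
    right″ = ext-get M S a i (suc j) right'
    below' : ∀ b → get (ext M S a) (suc i) j ≡ just b → code r < code b
    below' b eq with get-ext M S a (suc i) j eq
    ... | inj₁ eq'  = below b eq'
    ... | inj₂ refl = get-below S i (suc j) right' bs

  -- The slide after a cancellation: the hole replaces the first M of row k, and with row k + 1
  -- empty it runs through the other n copies.
  Slides-last : ∀ {S} a k {n} → Proper S → Fits S a → a k ≡ suc n → len S (suc k) + a (suc k) ≡ 0 →
    Slides n (ext M S a) k (len S k) k (ext M S (dec k a))
  Slides-last {[]} a (suc k) ps fits a≡ below≡0 rewrite Fits[]⇒0 {a} fits k = contradiction a≡ λ ()
  Slides-last {r ∷ S} a (suc k) (p ∷ ps) fits a≡ below≡0 =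
    Slides-∷ (λ eq → p (++-conicalˡ r _ eq)) (Slides-last (a ∘ suc) k ps (Fits-tail {r} {S} {a} fits) a≡ below≡0)
  Slides-last {[]} a zero {n} ps fits a≡ below≡0 rewrite a≡ =
    subst (Slides n _ 0 0 0) (result n) (run-right [] [] M n z≤n)
    where
    result : ∀ n → dropEmpty (replicate n M ∷ []) ≡ topRow M n
    result zero    = refl
    result (suc n) = refl
  Slides-last {r ∷ S} a zero {n} (p ∷ ps) fits a≡ below≡0 rewrite a≡ =
    subst (Slides n _ 0 (length r) 0)
      (dropEmpty-proper ((λ eq → p (++-conicalˡ r _ eq)) ∷ proper-ext M (a ∘ suc) ps))
      (run-right (ext M S (a ∘ suc)) r M n
        (≤-trans (≤-reflexive (trans (len-ext M S (a ∘ suc) (Fits-tail {r} {S} {a} fits) 0) below≡0)) z≤n))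

-- Sp-tableaux as towers of strips, one strip per letter

infix 4 _⋖_

data _⋖_ : Letter → Letter → Set where
  plain⋖bar : ∀ {m} → plain m ⋖ bar m
  bar⋖plain : ∀ {m} → bar m ⋖ plain (suc m)

⋖-code : ∀ {M' M} → M' ⋖ M → code M ≡ suc (code M')
⋖-code plain⋖bar       = refl
⋖-code (bar⋖plain {m}) = cong suc (+-suc m (m + 0))

⋖-idx : ∀ {M' M} → M' ⋖ M → idx M' ≤ idx M
⋖-idx plain⋖bar = ≤-refl
⋖-idx bar⋖plain = n≤1+n _

≤M' : ∀ {M' M x} → M' ⋖ M → code x < code M → code x ≤ code M'
≤M' lev x<M = s≤s⁻¹ (≤-trans x<M (≤-reflexive (⋖-code lev)))

M'< : ∀ {M' M x} → M' ⋖ M → code x ≤ code M' → code x < code M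
M'< lev x≤ = ≤-trans (s≤s x≤) (≤-reflexive (sym (⋖-code lev)))

code-injective : ∀ {x y} → code x ≡ code y → x ≡ y
code-injective {plain a} {plain b} eq = cong plain (*-cancelˡ-≡ a b 2 eq)
code-injective {plain a} {bar b}   eq = contradiction eq (even≢odd a b)
code-injective {bar a}   {plain b} eq = contradiction (sym eq) (even≢odd b a)
code-injective {bar a}   {bar b}   eq = cong bar (*-cancelˡ-≡ a b 2 (suc-injective eq))

2*≤1+2*⇒≤ : ∀ {a b} → 2 * a ≤ suc (2 * b) → a ≤ b
2*≤1+2*⇒≤ {a} {b} le = ≮⇒≥ λ b<a →
  <⇒≱ (s≤s (≤-reflexive (sym (+-suc b (b + 0))))) (≤-trans (*-monoʳ-≤ 2 b<a) le)

code-≤⇒idx-≤ : ∀ x y → code x ≤ code y → idx x ≤ idx y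
code-≤⇒idx-≤ (plain a) (plain b) le = *-cancelˡ-≤ 2 le
code-≤⇒idx-≤ (plain a) (bar b)   le = 2*≤1+2*⇒≤ le
code-≤⇒idx-≤ (bar a)   (plain b) le = *-cancelˡ-≤ 2 (≤-trans (n≤1+n _) le)
code-≤⇒idx-≤ (bar a)   (bar b)   le = *-cancelˡ-≤ 2 (s≤s⁻¹ le)

1≤idx⇒2≤code : ∀ x → 1 ≤ idx x → 2 ≤ code x
1≤idx⇒2≤code (plain k) le = *-monoʳ-≤ 2 le
1≤idx⇒2≤code (bar k)   le = m≤n⇒m≤1+n (*-monoʳ-≤ 2 le)

Bounded : Letter → (ℕ → ℕ) → Set
Bounded M a = ∀ i → idx M ≤ i → a i ≡ 0

-- `bar 0` is a fictitious letter just below the alphabet. `Bounded` is the symplectic row condition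
-- with rows counted from 0. A letter that does not occur contributes the zero strip.
data Tbl : Letter → Tab → Set where
  base  : Tbl (bar 0) []
  level : ∀ {M' M S} a → M' ⋖ M → Tbl M' S → Fits S a → Bounded M a → Tbl M (ext M S a)

tbl-below : ∀ {M T} → Tbl M T → Below (suc (code M)) T
tbl-below base = []
tbl-below {M} (level {S = S} a lev t fits bnd) =
  below-ext M a (subst (λ c → Below c S) (sym (⋖-code lev)) (tbl-below t))

tbl-below-⋖ : ∀ {M' M T} → M' ⋖ M → Tbl M' T → Below (code M) T
tbl-below-⋖ {T = T} lev t = subst (λ c → Below c T) (sym (⋖-code lev)) (tbl-below t)

tbl-proper : ∀ {M T} → Tbl M T → Proper T
tbl-proper base = []
tbl-proper {M} (level a lev t fits bnd) = proper-ext M a (tbl-proper t)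

tbl-rows : ∀ {M T} → Tbl M T → Bounded M (len T)
tbl-rows base i le = refl
tbl-rows {M} (level {S = S} a lev t fits bnd) i le =
  trans (len-ext M S a fits i) (cong₂ _+_ (tbl-rows t i (≤-trans (⋖-idx lev) le)) (bnd i le))

tbl-antitone : ∀ {M T} → Tbl M T → ∀ i → len T (suc i) ≤ len T i
tbl-antitone base i = z≤n
tbl-antitone {M} (level {S = S} a lev t fits bnd) i
  rewrite len-ext M S a fits i | len-ext M S a fits (suc i) = ≤-trans (fits i) (m≤m+n _ _)

tbl-[] : ∀ m → Tbl (bar m) []
tbl-[] zero    = base
tbl-[] (suc m) = level (λ _ → 0) plain⋖bar (level (λ _ → 0) bar⋖plain (tbl-[] m) (λ _ → z≤n) (λ _ _ → refl))
                   (λ _ → z≤n) (λ _ _ → refl)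

tbl-[]ᵖ : ∀ {m} → 1 ≤ m → Tbl (plain m) []
tbl-[]ᵖ {suc m} _ = level (λ _ → 0) bar⋖plain (tbl-[] m) (λ _ → z≤n) (λ _ _ → refl)

-- The effect of one insertion, level by level

-- Needed one level higher, when m̄ is cancelled by an m: it shows that the tableau in which this m
-- was placed exceeds the one in which it was erased by an m at the end of the strip in row k.
data Placed (M : Letter) (k : ℕ) : Tab → Tab → Set where
  placed : ∀ {M' S} a → M' ⋖ M → Tbl M' S → Fits S (inc k a) → Bounded M (inc k a) →
           Placed M k (ext M S a) (ext M S (inc k a))

-- All that the strip of the next larger letter can feel. `grow` keeps R because a cancellation one
-- level up erases y, and `suc k ≤ idx y` because it identifies the cancelling letter. `shrink`
-- keeps the tableau T₁ with the hole, whose size is the fuel of the slide.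
data Step (M x : Letter) (T T' : Tab) : Set where
  grow   : ∀ k y {R} → Ins 1 x T k y R T' → Tbl M R → suc k ≤ idx y → code y ≤ code M →
           (y ≡ M → Placed M k R T') → len R ≗ len T → len T' ≗ inc k (len T) → Step M x T T'
  shrink : ∀ k {p q n T₁} → Can 1 x T p q T₁ → Slides n T₁ p q k T' → n ≤ size T₁ → q < len T₁ p →
           Proper T₁ → Below (suc (code M)) T₁ → len T₁ ≗ len T → len T ≗ inc k (len T') → Step M x T T'

step⇒berIns : ∀ {M x T T'} → Step M x T T' → berIns T x ≡ T'
step⇒berIns (grow k y ins _ _ _ _ _ _) rewrite Ins⇒insGo ins = refl
step⇒berIns (shrink k can sl n≤ _ _ _ _ _) rewrite Can⇒insGo can = slide-correct _ sl n≤

inc-+ˡ : ∀ k (f g : ℕ → ℕ) i → inc k f i + g i ≡ inc k (λ j → f j + g j) i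
inc-+ˡ zero    f g zero    = refl
inc-+ˡ zero    f g (suc i) = refl
inc-+ˡ (suc k) f g zero    = refl
inc-+ˡ (suc k) f g (suc i) = inc-+ˡ k (f ∘ suc) (g ∘ suc) i

inc-+ʳ : ∀ k (f g : ℕ → ℕ) i → f i + inc k g i ≡ inc k (λ j → f j + g j) i
inc-+ʳ zero    f g zero    = +-suc _ _
inc-+ʳ zero    f g (suc i) = refl
inc-+ʳ (suc k) f g zero    = refl
inc-+ʳ (suc k) f g (suc i) = inc-+ʳ k (f ∘ suc) (g ∘ suc) i

-- The new cell of S takes the place of an M, so the row lengths stay the same until that M is
-- placed again.
inc-+-dec : ∀ k a {f f'} → a k ≢ 0 → f' ≗ inc k f → ∀ i → f' i + dec k a i ≡ f i + a i
inc-+-dec k a {f} {f'} a≢0 f'≗ i = begin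
  f' i + dec k a i              ≡⟨ cong (_+ dec k a i) (f'≗ i) ⟩
  inc k f i + dec k a i         ≡⟨ inc-+ˡ k f (dec k a) i ⟩
  inc k (λ j → f j + dec k a j) i ≡⟨ sym (inc-+ʳ k f (dec k a) i) ⟩
  f i + inc k (dec k a) i       ≡⟨ cong (f i +_) (inc-dec k a a≢0 i) ⟩
  f i + a i                     ∎
  where open ≡-Reasoning

inc-+-shift : ∀ k a {f f'} → a (suc k) ≢ 0 → f ≗ inc k f' → ∀ i →
  f i + a i ≡ inc (suc k) (λ j → f' j + inc k (dec (suc k) a) j) i
inc-+-shift k a {f} {f'} a≢0 f≗ i = begin
  f i + a i                                  ≡⟨ cong (_+ a i) (f≗ i) ⟩
  inc k f' i + a i                           ≡⟨ inc-+ˡ k f' a i ⟩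
  inc k (λ j → f' j + a j) i                 ≡⟨ sym (inc-+ʳ k f' a i) ⟩
  f' i + inc k a i                           ≡⟨ cong (f' i +_) (inc-cong k (λ j → sym (inc-dec (suc k) a a≢0 j)) i) ⟩
  f' i + inc k (inc (suc k) (dec (suc k) a)) i ≡⟨ cong (f' i +_) (inc-comm k (suc k) (dec (suc k) a) i) ⟩
  f' i + inc (suc k) (inc k (dec (suc k) a)) i ≡⟨ inc-+ʳ (suc k) f' (inc k (dec (suc k) a)) i ⟩
  inc (suc k) (λ j → f' j + inc k (dec (suc k) a) j) i ∎
  where open ≡-Reasoning

≡ᵇ-refl : ∀ n → (n ≡ᵇ n) ≡ true
≡ᵇ-refl n = Equivalence.to T-≡ (≡⇒≡ᵇ n n refl)

≢⇒≡ᵇ-false : ∀ {m n} → m ≢ n → (m ≡ᵇ n) ≡ false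
≢⇒≡ᵇ-false {m} {n} m≢n with m ≡ᵇ n in eq
... | false = refl
... | true  = contradiction (≡ᵇ⇒≡ m n (Equivalence.from T-≡ eq)) m≢n

cancel-no : ∀ k y M → M ≢ bar k → isCancel k y M ≡ false
cancel-no k y (plain m) M≢ = ∧-zeroʳ _
cancel-no k y (bar m)   M≢ rewrite ≢⇒≡ᵇ-false {m} {k} (M≢ ∘ cong bar) = ∧-zeroʳ _

-- In row k the symplectic condition leaves `plain k` as the only letter below `bar k`.
cancel-yes : ∀ k y → k ≤ idx y → code y < code (bar k) → isCancel k y (bar k) ≡ true
cancel-yes k (plain m) k≤m lt with ≤-antisym k≤m (2*≤1+2*⇒≤ {m} {k} (<⇒≤ lt))
... | refl rewrite ≡ᵇ-refl m = refl
cancel-yes k (bar m) k≤m lt = contradiction (*-monoʳ-≤ 2 k≤m) (<⇒≱ (s<s⁻¹ lt))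

-- S' is still a partition after losing a cell in row k, so row k + 1 of S is strictly shorter than
-- row k, and an M must make up the difference.
jump⇒≢0 : ∀ {k S S'} {a : ℕ → ℕ} → len S ≗ inc k (len S') → len S' (suc k) ≤ len S' k →
  len S (suc k) + a (suc k) ≡ len S k → a (suc k) ≢ 0
jump⇒≢0 {k} {S} {S'} {a} lenS' anti eq a≡0 = <-irrefl refl (begin-strict
  len S' k                  <⟨ ≤-reflexive (sym (trans (lenS' k) (inc-at k (len S')))) ⟩
  len S k                   ≡⟨ sym eq ⟩
  len S (suc k) + a (suc k) ≡⟨ cong (len S (suc k) +_) a≡0 ⟩
  len S (suc k) + 0         ≡⟨ +-identityʳ _ ⟩
  len S (suc k)             ≡⟨ trans (lenS' (suc k)) (inc-off k (len S') 1+n≢n) ⟩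
  len S' (suc k)            ≤⟨ anti ⟩
  len S' k ∎)
  where open ≤-Reasoning

bar-dec : ∀ M m → Dec (M ≡ bar m)
bar-dec (plain k) m = no λ ()
bar-dec (bar k)   m with k ≟ m
... | yes refl = yes refl
... | no k≢m   = no λ { refl → k≢m refl }

record Next (M x : Letter) (S : Tab) (a : ℕ → ℕ) (S⁺ : Tab) (a⁺ : ℕ → ℕ) : Set where
  constructor next
  field
    step-ext : Step M x (ext M S a) (ext M S⁺ a⁺)
    fits⁺    : Fits S⁺ a⁺
    bnd⁺     : Bounded M a⁺

  berIns-ext : berIns (ext M S a) x ≡ ext M S⁺ a⁺
  berIns-ext = step⇒berIns step-ext

module _ {M' M : Letter} (lev : M' ⋖ M) {S : Tab} (tS : Tbl M' S) (a : ℕ → ℕ) (fits : Fits S a) (bnd : Bounded M a) where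

  private
    T₀ = ext M S a

    len-T₀ : len T₀ ≗ λ i → len S i + a i
    len-T₀ = len-ext M S a fits

  next-max : 1 ≤ idx M → Next M M S a S (inc 0 a)
  next-max 1≤M = next
    (grow 0 M (Ins-max M 1 S a fits (All.map (All.map m<n⇒m<1+n) (tbl-below-⋖ lev tS)))
      (level a lev tS fits bnd) 1≤M ≤-refl (λ _ → placed a lev tS fits⁺ bnd⁺) (λ _ → refl)
      (λ i → trans (len-ext M S (inc 0 a) fits⁺ i)
               (trans (inc-+ʳ 0 (len S) a i) (inc-cong 0 (λ j → sym (len-T₀ j)) i))))
    fits⁺ bnd⁺
    where
    fits⁺ : Fits S (inc 0 a)
    fits⁺ i = fits i
    bnd⁺ : Bounded M (inc 0 a)
    bnd⁺ zero    le = contradiction (≤-trans 1≤M le) λ ()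
    bnd⁺ (suc i) le = bnd (suc i) le

  module _ {x : Letter} (x<M : code x < code M) {S' : Tab} (tS' : Tbl M' S') where

    private
      grow-mono : ∀ {k} → len S' ≗ inc k (len S) → ∀ i → len S i ≤ len S' i
      grow-mono {k} eq i = ≤-trans (≤-inc k (len S) i) (≤-reflexive (sym (eq i)))

    next-free : ∀ {k y R} → Ins 1 x S k y R S' → Tbl M' R → suc k ≤ idx y → code y ≤ code M' →
      len R ≗ len S → len S' ≗ inc k (len S) → a k ≡ 0 → Next M x S a S' a
    next-free {k} {y} {R} ins tR k<y y≤ lenR lenS' a≡0 = next
      (grow k y (Ins-free M a fits a≡0 ins)
        (level a lev tR fitsR bnd) k<y (<⇒≤ (M'< {x = y} lev y≤))
        (λ y≡M → contradiction (cong code y≡M) (<⇒≢ (M'< {x = y} lev y≤)))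
        (λ i → trans (len-ext M R a fitsR i) (trans (cong (_+ a i) (lenR i)) (sym (len-T₀ i))))
        (λ i → trans (len-ext M S' a fits⁺ i) (trans (cong (_+ a i) (lenS' i))
                 (trans (inc-+ˡ k (len S) a i) (inc-cong k (λ j → sym (len-T₀ j)) i)))))
      fits⁺ bnd
      where
      fitsR : Fits R a
      fitsR = Fits-cong {S} {R} {a} lenR fits
      fits⁺ : Fits S' a
      fits⁺ i with suc i ≟ k
      -- The lengthened row k carries no M, so the strip condition there says only that S' is a
      -- partition.
      ... | yes refl rewrite a≡0 | +-identityʳ (len S' (suc i)) = tbl-antitone tS' i
      ... | no i≢k rewrite trans (lenS' (suc i)) (inc-off k (len S) i≢k) = ≤-trans (fits i) (grow-mono {k} lenS' i)

    next-bump : ∀ {k y R} → Ins 1 x S k y R S' → suc k ≤ idx y → code y ≤ code M' →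
      len S' ≗ inc k (len S) → a k ≢ 0 → M ≢ bar (suc k) → Next M x S a S' (inc (suc k) (dec k a))
    next-bump {k} {y} {R} ins k<y y≤ lenS' a≢0 M≢ with a k in a≡
    ... | zero  = contradiction refl a≢0
    ... | suc n = next
      (grow (suc k) M (Ins-bump M a fits (tbl-below-⋖ lev tS) x<M a≡ (cancel-no (suc k) y M M≢) ins)
        (level (dec k a) lev tS' fitsR bndR) (k< lev M≢ (≤-trans k<y (code-≤⇒idx-≤ y M' y≤))) ≤-refl
        (λ _ → placed (dec k a) lev tS' fits⁺ bnd⁺)
        (λ i → trans (len-ext M S' (dec k a) fitsR i) (trans (lens i) (sym (len-T₀ i))))
        (λ i → trans (len-ext M S' a⁺ fits⁺ i)
                 (trans (inc-+ʳ (suc k) (len S') (dec k a) i)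
                   (inc-cong (suc k) (λ j → trans (lens j) (sym (len-T₀ j))) i))))
      fits⁺ bnd⁺
      where
      a⁺ = inc (suc k) (dec k a)
      -- The bumped M obeys the row condition in its new row: y < M already satisfies it in row k,
      -- so it could fail only for M = `bar (suc k)`, the case of a cancellation.
      k< : ∀ {M' M} → M' ⋖ M → M ≢ bar (suc k) → suc k ≤ idx M' → suc (suc k) ≤ idx M
      k< plain⋖bar M≢ le = ≤∧≢⇒< le (M≢ ∘ cong bar ∘ sym)
      k< bar⋖plain M≢ le = s≤s le
      lens : ∀ i → len S' i + dec k a i ≡ len S i + a i
      lens = inc-+-dec k a (λ eq → contradiction (trans (sym a≡) eq) λ ()) lenS'
      fits⁺ : Fits S' a⁺
      fits⁺ i with i ≟ k | lens (suc i)
      ... | yes refl | l rewrite inc-at (suc i) (dec i a) | +-suc (len S' (suc i)) (dec i a (suc i)) | l | lenS' i | inc-at i (len S) = s≤s (fits i)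
      ... | no i≢k | l rewrite inc-off k (dec k a ∘ suc) i≢k | l = ≤-trans (fits i) (grow-mono {k} lenS' i)
      fitsR : Fits S' (dec k a)
      fitsR = Fits-mono {S'} {a⁺} (≤-inc (suc k) (dec k a)) fits⁺
      bnd⁺ : Bounded M a⁺
      bnd⁺ i le = trans (inc-off (suc k) (dec k a) (λ eq → <⇒≱ (k< lev M≢ (≤-trans k<y (code-≤⇒idx-≤ y M' y≤))) (≤-trans le (≤-reflexive eq))))
                    (n≤0⇒n≡0 (≤-trans (dec-≤ k a i) (≤-reflexive (bnd i le))))
      bndR : Bounded M (dec k a)
      bndR i le = n≤0⇒n≡0 (≤-trans (≤-inc (suc k) (dec k a) i) (≤-reflexive (bnd⁺ i le)))

    next-cancel : ∀ {k y R} → Ins 1 x S k y R S' → Tbl M' R → suc k ≤ idx y → code y ≤ code M' →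
      len R ≗ len S → a k ≢ 0 → M ≡ bar (suc k) → Next M x S a R (dec k a)
    next-cancel {k} {y} {R} ins tR k<y y≤ lenR a≢0 refl with a k in a≡
    ... | zero  = contradiction refl a≢0
    ... | suc n = next
      (shrink k
        (subst (λ q → Can 1 x T₀ k q (ext M R a)) (sym (lenR k))
          (Ins-cancel M a fits (tbl-below-⋖ lev tS) x<M a≡ (cancel-yes (suc k) y k<y (M'< {x = y} lev y≤)) ins))
        (Slides-last M a k (tbl-proper tR) fitsR a≡ below≡0)
        n≤
        (subst (len R k <_) (sym (trans (len-ext M R a fitsR k) (cong (len R k +_) a≡))) (m<m+n (len R k) z<s))
        (proper-ext M a (tbl-proper tR))
        (below-ext M a (tbl-below-⋖ lev tR))
        (λ i → trans (len-ext M R a fitsR i) (trans (cong (_+ a i) (lenR i)) (sym (len-T₀ i))))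
        (λ i → trans (len-T₀ i) (trans (cong₂ _+_ (sym (lenR i)) (sym (inc-dec k a (λ eq → contradiction (trans (sym a≡) eq) λ ()) i)))
                 (trans (inc-+ʳ k (len R) (dec k a) i) (inc-cong k (λ j → sym (len-ext M R (dec k a) fits⁺ j)) i)))))
      fits⁺ (λ i le → n≤0⇒n≡0 (≤-trans (dec-≤ k a i) (≤-reflexive (bnd i le))))
      where
      fitsR : Fits R a
      fitsR = Fits-cong {S} {R} {a} lenR fits
      fits⁺ : Fits R (dec k a)
      fits⁺ = Fits-mono {R} {a} (dec-≤ k a) fitsR
      -- Row k is the last one that letters up to `bar (suc k)` may enter.
      below≡0 : len R (suc k) + a (suc k) ≡ 0
      below≡0 = cong₂ _+_ (trans (lenR (suc k)) (tbl-rows tS (suc k) (⋖-idx lev))) (bnd (suc k) ≤-refl)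
      n≤ : n ≤ size (ext M R a)
      n≤ = ≤-trans (n≤1+n n) (≤-trans (≤-reflexive (sym a≡)) (≤-trans (m≤n+m (a k) (size R)) (size-ext M R a fitsR k)))

    module _ {k p q n S₁} (can : Can 1 x S p q S₁) (sl : Slides n S₁ p q k S') (n≤ : n ≤ size S₁) (q< : q < len S₁ p)
             (pr : Proper S₁) (be : Below (suc (code M')) S₁) (lenS₁ : len S₁ ≗ len S) (lenS' : len S ≗ inc k (len S')) where

      private
        fits₁ : Fits S₁ a
        fits₁ = Fits-cong {S} {S₁} {a} lenS₁ fits

        be' : Below (code M) S₁
        be' = subst (λ c → Below c S₁) (sym (⋖-code lev)) be

        len₁ : len (ext M S₁ a) ≗ len T₀
        len₁ i = trans (len-ext M S₁ a fits₁ i) (trans (cong (_+ a i) (lenS₁ i)) (sym (len-T₀ i)))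

        q<₁ : q < len (ext M S₁ a) p
        q<₁ = <-≤-trans q< (≤-trans (m≤m+n _ (a p)) (≤-reflexive (sym (len-ext M S₁ a fits₁ p))))

        S'≤ : ∀ i → len S' i ≤ len S i
        S'≤ i = ≤-trans (≤-inc k (len S') i) (≤-reflexive (sym (lenS' i)))

        lenk : len S k ≡ suc (len S' k)
        lenk = trans (lenS' k) (inc-at k (len S'))

        offk : ∀ {i} → i ≢ k → len S' i ≡ len S i
        offk {i} i≢k = sym (trans (lenS' i) (inc-off k (len S') i≢k))

      next-slide : len S (suc k) + a (suc k) < len S k → Next M x S a S' a
      next-slide lt = next
        (shrink k (Can-ext M a can)
          (proj₁ (Slides-ext M a pr be' fits₁ q< sl)
            (subst₂ (λ u v → u + a (suc k) < v) (sym (lenS₁ (suc k))) (sym (lenS₁ k)) lt))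
          (≤-trans (+-monoˡ-≤ (a k) n≤) (size-ext M S₁ a fits₁ k))
          q<₁ (proper-ext M a pr) (below-ext M a be') len₁
          (λ i → trans (len-T₀ i) (trans (cong (_+ a i) (lenS' i)) (trans (inc-+ˡ k (len S') a i)
                   (inc-cong k (λ j → sym (len-ext M S' a fits⁺ j)) i)))))
        fits⁺ bnd
        where
        fits⁺ : Fits S' a
        fits⁺ i with i ≟ k
        -- The strict inequality makes up for the cell that row k of S has lost.
        ... | yes refl = ≤-trans (+-monoˡ-≤ (a (suc i)) (S'≤ (suc i))) (s≤s⁻¹ (≤-trans lt (≤-reflexive lenk)))
        ... | no i≢k   = ≤-trans (+-monoˡ-≤ (a (suc i)) (S'≤ (suc i))) (≤-trans (fits i) (≤-reflexive (sym (offk i≢k))))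

      next-jump : len S (suc k) + a (suc k) ≡ len S k → Next M x S a S' (inc k (dec (suc k) a))
      next-jump eq = next
        (shrink (suc k) (Can-ext M a can)
          (proj₂ (Slides-ext M a pr be' fits₁ q< sl)
            (subst₂ (λ u v → u + a (suc k) ≡ v) (sym (lenS₁ (suc k))) (sym (lenS₁ k)) eq))
          (≤-trans (+-mono-≤ n≤ (n≢0⇒n>0 a≢0)) (size-ext M S₁ a fits₁ (suc k)))
          q<₁ (proper-ext M a pr) (below-ext M a be') len₁
          (λ i → trans (len-T₀ i) (trans (lens i) (inc-cong (suc k) (λ j → sym (len-ext M S' a⁺ fits⁺ j)) i))))
        fits⁺ bnd⁺
        where
        a⁺ = inc k (dec (suc k) a)
        a≢0 = jump⇒≢0 {k} {S} {S'} {a} lenS' (tbl-antitone tS' k) eq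
        lens : ∀ i → len S i + a i ≡ inc (suc k) (λ j → len S' j + a⁺ j) i
        lens = inc-+-shift k a a≢0 lenS'
        fits⁺ : Fits S' a⁺
        fits⁺ i with i ≟ k
        ... | yes refl rewrite inc-off i (dec (suc i) a) (1+n≢n {i}) | dec-at i (a ∘ suc) | offk (1+n≢n {i}) = begin
          len S (suc i) + pred (a (suc i))        ≡⟨ cong pred (trans (sym (+-suc _ _)) (cong (len S (suc i) +_) (suc-pred _ {{≢-nonZero a≢0}}))) ⟩
          pred (len S (suc i) + a (suc i))        ≡⟨ cong pred (trans eq lenk) ⟩
          len S' i ∎
          where open ≤-Reasoning
        ... | no i≢k with suc i ≟ k
        ...   | yes refl rewrite inc-at (suc i) (dec (suc (suc i)) a) | dec-off (suc i) (a ∘ suc) {i} (1+n≢n ∘ sym) | +-suc (len S' (suc i)) (a (suc i)) | offk i≢k =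
          ≤-trans (≤-reflexive (cong (_+ a (suc i)) (sym lenk))) (fits i)
        ...   | no si≢k  rewrite inc-off k (dec (suc k) a) si≢k | dec-off k (a ∘ suc) i≢k | offk si≢k | offk i≢k = fits i
        bnd⁺ : Bounded M a⁺
        bnd⁺ i le = trans (inc-off k (dec (suc k) a) (λ i≡k → a≢0 (bnd (suc k) (≤-trans le (≤-trans (≤-reflexive i≡k) (n≤1+n k))))))
                      (n≤0⇒n≡0 (≤-trans (dec-≤ (suc k) a i) (≤-reflexive (bnd i le))))

module _ {M' M : Letter} (lev : M' ⋖ M) {S S' : Tab} (tS : Tbl M' S) (tS' : Tbl M' S') {x : Letter} (x<M : code x < code M) where

  tbl-step-level : (a : ℕ → ℕ) (fits : Fits S a) (bnd : Bounded M a) → Step M' x S S' →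
    ∃ λ T' → Step M x (ext M S a) T' × Tbl M T'
  tbl-step-level a fits bnd (grow k y ins tR k<y y≤ _ lenR lenS') with a k ≟ 0
  ... | yes a≡0 = let n = next-free lev tS a fits bnd x<M tS' ins tR k<y y≤ lenR lenS' a≡0 in
    _ , Next.step-ext n , level _ lev tS' (Next.fits⁺ n) (Next.bnd⁺ n)
  ... | no a≢0 with bar-dec M (suc k)
  ...   | yes M≡ = let n = next-cancel lev tS a fits bnd x<M tS' ins tR k<y y≤ lenR a≢0 M≡ in
    _ , Next.step-ext n , level _ lev tR (Next.fits⁺ n) (Next.bnd⁺ n)
  ...   | no M≢  = let n = next-bump lev tS a fits bnd x<M tS' ins k<y y≤ lenS' a≢0 M≢ in
    _ , Next.step-ext n , level _ lev tS' (Next.fits⁺ n) (Next.bnd⁺ n)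
  tbl-step-level a fits bnd (shrink k can sl n≤ q< pr be lenS₁ lenS')
    with m≤n⇒m<n∨m≡n (fits k)
  ... | inj₁ lt = let n = next-slide lev tS a fits bnd x<M tS' can sl n≤ q< pr be lenS₁ lenS' lt in
    _ , Next.step-ext n , level _ lev tS' (Next.fits⁺ n) (Next.bnd⁺ n)
  ... | inj₂ eq = let n = next-jump lev tS a fits bnd x<M tS' can sl n≤ q< pr be lenS₁ lenS' eq in
    _ , Next.step-ext n , level _ lev tS' (Next.fits⁺ n) (Next.bnd⁺ n)

-- Induction down the tower to the level of x itself, where x is appended to the first row; from
-- there the effect is passed up again through the strips of larger letters. The base level is never
-- reached, as letters of positive index exceed `bar 0`.
tbl-step : ∀ {M T x} → Tbl M T → 1 ≤ idx x → code x ≤ code M → ∃ λ T' → Step M x T T' × Tbl M T'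
tbl-step {x = x} base 1≤x x≤ = contradiction (≤-trans (1≤idx⇒2≤code x 1≤x) x≤) λ { (s≤s ()) }
tbl-step {M} {x = x} (level a lev t fits bnd) 1≤x x≤ with m≤n⇒m<n∨m≡n x≤
... | inj₂ eq rewrite code-injective {x} {M} eq = let n = next-max lev t a fits bnd 1≤x in
  _ , Next.step-ext n , level _ lev t (Next.fits⁺ n) (Next.bnd⁺ n)
... | inj₁ x<M with tbl-step t 1≤x (≤M' {x = x} lev x<M)
... | S' , st , t' = tbl-step-level lev t t' x<M a fits bnd st

tbl-berIns : ∀ {M T x} → Tbl M T → 1 ≤ idx x → code x ≤ code M → Tbl M (berIns T x)
tbl-berIns {M} t 1≤x x≤ with tbl-step t 1≤x x≤
... | T' , st , t' = subst (Tbl M) (sym (step⇒berIns st)) t'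

-- Two runs side by side: the two phases

Bounded-cong : ∀ {M} {a b : ℕ → ℕ} → b ≗ a → Bounded M a → Bounded M b
Bounded-cong eq bnd i le = trans (eq i) (bnd i le)

Bounded-mono : ∀ {M} {a b : ℕ → ℕ} → (∀ i → b i ≤ a i) → Bounded M a → Bounded M b
Bounded-mono le bnd i le' = n≤0⇒n≡0 (≤-trans (le i) (≤-reflexive (bnd i le')))

ext-zero : ∀ M S a → (∀ i → a i ≡ 0) → ext M S a ≡ S
ext-zero M []      a eq rewrite eq 0 = refl
ext-zero M (r ∷ S) a eq rewrite eq 0 | ++-identityʳ r = cong (r ∷_) (ext-zero M S (a ∘ suc) (eq ∘ suc))

inc-≢0 : ∀ r {k} (a : ℕ → ℕ) → a k ≢ 0 → inc r a k ≢ 0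
inc-≢0 r {k} a a≢0 eq = a≢0 (n≤0⇒n≡0 (≤-trans (≤-inc r a k) (≤-reflexive eq)))

inc-at≢0 : ∀ r (a : ℕ → ℕ) → inc r a r ≢ 0
inc-at≢0 r a eq rewrite inc-at r a = contradiction eq λ ()

largest-plain : ∀ {m} y → m ≤ idx y → code y ≤ code (plain m) → y ≡ plain m
largest-plain (plain k) m≤ y≤ = cong plain (≤-antisym (*-cancelˡ-≤ 2 y≤) m≤)
largest-plain (bar k)   m≤ y≤ = contradiction (*-monoʳ-≤ 2 m≤) (<⇒≱ y≤)

⋖-bar : ∀ {M m} → M ⋖ bar m → M ≡ plain m
⋖-bar plain⋖bar = refl

-- No M in the rows above row r, whose indices are smaller. The strip being horizontal, the last M
-- of row r is then the rightmost one.
ZeroBelow : ℕ → (ℕ → ℕ) → Set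
ZeroBelow r a = ∀ i → i < r → a i ≡ 0

ZeroBelow⇒≤ : ∀ {r a} → ZeroBelow r a → ∀ {k} → a k ≢ 0 → r ≤ k
ZeroBelow⇒≤ z a≢0 = ≮⇒≥ λ k<r → a≢0 (z _ k<r)

-- Before a cancellation of the distinguished M, the two tableaux differ by the
-- rightmost M of the larger one.
data Phase₁ (M : Letter) : Tab → Tab → Set where
  phase₁ : ∀ {M' S r} a → M' ⋖ M → Tbl M' S → Fits S (inc r a) → Bounded M (inc r a) → ZeroBelow r a →
           Phase₁ M (ext M S (inc r a)) (ext M S a)

-- After it, T' has one more m than T.  Tail says that the strip of m's meets each of
-- the columns up to its end in row r, which makes the next column the leftmost one
-- without m.
Tail : Tab → (ℕ → ℕ) → ℕ → Set
Tail S a r = ∀ i → r ≤ i → len S (suc i) + a (suc i) ≡ len S i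

data Phase₂ (m : ℕ) : Tab → Tab → Set where
  phase₂ : ∀ {M' S r} a → M' ⋖ plain m → Tbl M' S → Fits S (inc r a) → Bounded (plain m) (inc r a) → Tail S a r →
           Phase₂ m (ext (plain m) S a) (ext (plain m) S (inc r a))

-- The two length equations of `cross` are the pattern of (○): B has the shape C, and C exceeds D by
-- a cell in row r.
data Result₁ (M : Letter) (T T⁺ T'⁺ : Tab) : Set where
  stay  : Phase₁ M T⁺ T'⁺ → Result₁ M T T⁺ T'⁺
  cross : ∀ r → M ≡ bar (suc r) → Phase₂ (suc r) T⁺ T'⁺ → len T'⁺ ≗ len T → len T ≗ inc r (len T⁺) →
          Result₁ M T T⁺ T'⁺

module _ {M' M : Letter} (lev : M' ⋖ M) {S : Tab} (tS : Tbl M' S) {r : ℕ} (a : ℕ → ℕ)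
         (fits : Fits S (inc r a)) (bnd : Bounded M (inc r a)) where

  private
    fits' : Fits S a
    fits' = Fits-mono {S} {inc r a} (≤-inc r a) fits

    bnd' : Bounded M a
    bnd' = Bounded-mono {M} (≤-inc r a) bnd

  module _ (zero<r : ZeroBelow r a) {x : Letter} (x<M : code x < code M) where

    private
      mk : ∀ {S⁺ a⁺ b r⁺} → Tbl M' S⁺ → Next M x S (inc r a) S⁺ b → Next M x S a S⁺ a⁺ →
           b ≗ inc r⁺ a⁺ → ZeroBelow r⁺ a⁺ →
           Phase₁ M (berIns (ext M S (inc r a)) x) (berIns (ext M S a) x)
      mk {S⁺} {a⁺} {b} {r⁺} t n n' eq z =
        subst₂ (Phase₁ M) (trans (sym (ext-cong M S⁺ eq)) (sym (Next.berIns-ext n))) (sym (Next.berIns-ext n'))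
          (phase₁ a⁺ lev t (Fits-mono {S⁺} {b} (λ i → ≤-reflexive (sym (eq i))) (Next.fits⁺ n))
            (Bounded-cong {M} (λ i → sym (eq i)) (Next.bnd⁺ n)) z)

    -- The strips can react differently only where the distinguished M decides: when S grows in row
    -- r and no other M is there, or when this M is what lets the hole jump into row r.
    phase₁-step : ∀ {S'} → Tbl M' S' → Step M' x S S' →
      Result₁ M (ext M S (inc r a)) (berIns (ext M S (inc r a)) x) (berIns (ext M S a) x)
    phase₁-step {S'} tS' (grow k y {R} ins tR k<y y≤ pl lenR lenS') with a k ≟ 0
    ... | no a≢0 with bar-dec M (suc k)
    ...   | yes M≡ = stay (mk tR
              (next-cancel lev tS (inc r a) fits bnd x<M tS' ins tR k<y y≤ lenR (inc-≢0 r a a≢0) M≡)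
              (next-cancel lev tS a fits' bnd' x<M tS' ins tR k<y y≤ lenR a≢0 M≡)
              (dec-inc-comm k r a a≢0)
              (λ i i<r → n≤0⇒n≡0 (≤-trans (dec-≤ k a i) (≤-reflexive (zero<r i i<r)))))
    ...   | no M≢ = stay (mk tS'
              (next-bump lev tS (inc r a) fits bnd x<M tS' ins k<y y≤ lenS' (inc-≢0 r a a≢0) M≢)
              (next-bump lev tS a fits' bnd' x<M tS' ins k<y y≤ lenS' a≢0 M≢)
              (λ i → trans (inc-cong (suc k) (dec-inc-comm k r a a≢0) i) (inc-comm (suc k) r (dec k a) i))
              (λ i i<r → trans (inc-off (suc k) (dec k a) (<⇒≢ (<-≤-trans i<r (≤-trans (ZeroBelow⇒≤ zero<r a≢0) (n≤1+n k)))))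
                 (n≤0⇒n≡0 (≤-trans (dec-≤ k a i) (≤-reflexive (zero<r i i<r))))))
    phase₁-step {S'} tS' (grow k y {R} ins tR k<y y≤ pl lenR lenS') | yes a≡0 with k ≟ r
    ... | no k≢r = stay (mk tS'
            (next-free lev tS (inc r a) fits bnd x<M tS' ins tR k<y y≤ lenR lenS' (trans (inc-off r a k≢r) a≡0))
            (next-free lev tS a fits' bnd' x<M tS' ins tR k<y y≤ lenR lenS' a≡0)
            (λ _ → refl) zero<r)
    ... | yes refl with bar-dec M (suc r)
    ...   | no M≢ = stay (mk tS'
              (next-bump lev tS (inc r a) fits bnd x<M tS' ins k<y y≤ lenS' (inc-at≢0 r a) M≢)
              (next-free lev tS a fits' bnd' x<M tS' ins tR k<y y≤ lenR lenS' a≡0)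
              (inc-cong (suc r) (dec-inc r a))
              (λ i i≤r → [ zero<r i , (λ { refl → a≡0 }) ]′ (m≤n⇒m<n∨m≡n (s≤s⁻¹ i≤r))))
    ...   | yes refl = cross r refl
              (subst₂ (Phase₂ (suc r))
                (trans (sym (ext-zero (bar (suc r)) R _ (λ i → trans (dec-inc r a i) (a≡0' i)))) (sym (Next.berIns-ext cancelled)))
                (trans (sym (ext-zero (bar (suc r)) S' a a≡0')) (sym (Next.berIns-ext free)))
                (start (subst (λ L → Placed L r R S') M'≡ (pl (trans y≡ (sym M'≡))))))
              (λ i → trans (cong (λ X → len X i) (trans (Next.berIns-ext free) (ext-zero (bar (suc r)) S' a a≡0'))) (trans (lenS' i) (sym (lenT i))))
              (λ i → trans (lenT i) (inc-cong r (λ j → sym (trans (cong (λ X → len X j)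
                (trans (Next.berIns-ext cancelled) (ext-zero (bar (suc r)) R _ (λ i → trans (dec-inc r a i) (a≡0' i))))) (lenR j))) i))
      where
      cancelled = next-cancel lev tS (inc r a) fits bnd x<M tS' ins tR k<y y≤ lenR (inc-at≢0 r a) refl
      free = next-free lev tS a fits' bnd' x<M tS' ins tR k<y y≤ lenR lenS' a≡0
      -- No other M exists: none above row r, none in row r, and none further down, as `bar (suc r)`
      -- may not go below row r.
      a≡0' : ∀ i → a i ≡ 0
      a≡0' i with <-cmp i r
      ... | tri< i<r _ _  = zero<r i i<r
      ... | tri≈ _ refl _ = a≡0
      ... | tri> _ _ r<i  = bnd' i r<i
      lenT : len (ext (bar (suc r)) S (inc r a)) ≗ inc r (len S)
      lenT i = trans (len-ext (bar (suc r)) S (inc r a) fits i) (trans (inc-+ʳ r (len S) a i)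
                 (inc-cong r (λ j → trans (cong (len S j +_) (a≡0' j)) (+-identityʳ _)) i))
      M'≡ : M' ≡ plain (suc r)
      M'≡ = ⋖-bar lev
      y≡ : y ≡ plain (suc r)
      y≡ = largest-plain y k<y (≤-trans y≤ (≤-reflexive (cong code M'≡)))
      -- S₀ has only letters up to `bar r`, so its rows from r on are empty and `Tail` becomes 0 =
      -- 0.
      start : Placed (plain (suc r)) r R S' → Phase₂ (suc r) R S'
      start (placed {S = S₀} b bar⋖plain tS₀ fits₀ bnd₀) = phase₂ b bar⋖plain tS₀ fits₀ bnd₀
        (λ i r≤i → trans (cong₂ _+_ (tbl-rows tS₀ (suc i) (m≤n⇒m≤1+n r≤i)) (Bounded-mono {plain (suc r)} (≤-inc r b) bnd₀ (suc i) (s≤s r≤i)))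
                     (sym (tbl-rows tS₀ i r≤i)))
    phase₁-step {S'} tS' (shrink k can sl n≤ q< pr be lenS₁ lenS') with m≤n⇒m<n∨m≡n (fits k) | suc k ≟ r
    ... | inj₁ lt | _ = stay (mk tS'
            (next-slide lev tS (inc r a) fits bnd x<M tS' can sl n≤ q< pr be lenS₁ lenS' lt)
            (next-slide lev tS a fits' bnd' x<M tS' can sl n≤ q< pr be lenS₁ lenS'
              (≤-<-trans (+-monoʳ-≤ (len S (suc k)) (≤-inc r a (suc k))) lt))
            (λ _ → refl) zero<r)
    -- Row r reaches as far as row k = r - 1 of S only thanks to the distinguished M. With it the
    -- hole jumps and the M rises to row k; without it the hole stays in row k.
    ... | inj₂ eq | yes refl = stay (mk tS'
            (next-jump lev tS (inc (suc k) a) fits bnd x<M tS' can sl n≤ q< pr be lenS₁ lenS' eq)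
            (next-slide lev tS a fits' bnd' x<M tS' can sl n≤ q< pr be lenS₁ lenS'
              (≤-reflexive (trans (sym (+-suc _ _)) (trans (cong (len S (suc k) +_) (sym (inc-at (suc k) a))) eq))))
            (inc-cong k (dec-inc (suc k) a))
            (λ i i<k → zero<r i (m<n⇒m<1+n i<k)))
    ... | inj₂ eq | no sk≢r = stay (mk tS'
            (next-jump lev tS (inc r a) fits bnd x<M tS' can sl n≤ q< pr be lenS₁ lenS' eq)
            (next-jump lev tS a fits' bnd' x<M tS' can sl n≤ q< pr be lenS₁ lenS' eq')
            (λ i → trans (inc-cong k (dec-inc-comm (suc k) r a a≢0) i) (inc-comm k r (dec (suc k) a) i))
            (λ i i<r → trans (inc-off k (dec (suc k) a) (<⇒≢ (<-≤-trans i<r r≤k)))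
               (n≤0⇒n≡0 (≤-trans (dec-≤ (suc k) a i) (≤-reflexive (zero<r i i<r))))))
      where
      eq' : len S (suc k) + a (suc k) ≡ len S k
      eq' = trans (cong (len S (suc k) +_) (sym (inc-off r a sk≢r))) eq
      a≢0 : a (suc k) ≢ 0
      a≢0 = jump⇒≢0 {k} {S} {S'} {a} lenS' (tbl-antitone tS' k) eq'
      r≤k : r ≤ k
      r≤k = s≤s⁻¹ (≤∧≢⇒< (ZeroBelow⇒≤ zero<r a≢0) (sk≢r ∘ sym))

_⊕_ : Tab → (ℕ → ℕ) → ℕ → ℕ
(S ⊕ a) i = len S i + a i

-- The shapes A , B , C , D at the vertices of a cell of the growth diagram that is
-- traversed by the two tableaux of the second phase.
data Cell (m : ℕ) (A B C D : ℕ → ℕ) : Set where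
  grown      : ∀ k r → D ≗ inc k C → B ≗ inc r D → A ≗ inc r C → Cell m A B C D
  grown-next : ∀ r → D ≗ inc r C → B ≗ inc (suc r) D → A ≗ inc r C → B (suc r) ≡ D r → Cell m A B C D
  shrunk     : ∀ k r → k ≢ r → C ≗ inc k D → B ≗ inc r D → A ≗ inc r C → Cell m A B C D
  shrunk-eq  : ∀ k → suc k < m → C ≗ inc k D → B ≗ inc k D → A ≗ inc (suc k) C → Cell m A B C D

inc-resp : ∀ k {f g f' g' : ℕ → ℕ} → f' ≗ f → g' ≗ g → f ≗ inc k g → f' ≗ inc k g'
inc-resp k f g eq i = trans (f i) (trans (eq i) (sym (inc-cong k g i)))

Cell-cong : ∀ {m A B C D A' B' C' D'} → A' ≗ A → B' ≗ B → C' ≗ C → D' ≗ D → Cell m A B C D → Cell m A' B' C' D'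
Cell-cong a b c d (grown k r p q s)        = grown k r (inc-resp k d c p) (inc-resp r b d q) (inc-resp r a c s)
Cell-cong a b c d (grown-next r p q s e)   = grown-next r (inc-resp r d c p) (inc-resp (suc r) b d q) (inc-resp r a c s)
                                               (trans (b (suc r)) (trans e (sym (d r))))
Cell-cong a b c d (shrunk k r k≢r p q s)   = shrunk k r k≢r (inc-resp k c d p) (inc-resp r b d q) (inc-resp r a c s)
Cell-cong a b c d (shrunk-eq k k<m p q s)  = shrunk-eq k k<m (inc-resp k c d p) (inc-resp k b d q) (inc-resp (suc k) a c s)

record Result₂ (m : ℕ) (T T' T⁺ T'⁺ : Tab) : Set where
  constructor result₂
  field
    phase : Phase₂ m T⁺ T'⁺
    cell  : Cell m (len T') (len T'⁺) (len T) (len T⁺)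

module _ {M' : Letter} {m : ℕ} (lev : M' ⋖ plain m) {S : Tab} (tS : Tbl M' S) {r : ℕ} (a : ℕ → ℕ)
         (fits : Fits S (inc r a)) (bnd : Bounded (plain m) (inc r a)) (tail : Tail S a r) where

  private
    fits' : Fits S a
    fits' = Fits-mono {S} {inc r a} (≤-inc r a) fits

    bnd' : Bounded (plain m) a
    bnd' = Bounded-mono {plain m} (≤-inc r a) bnd

    M≢ : ∀ {k} → plain m ≢ bar k
    M≢ ()

    A≗ : (S ⊕ inc r a) ≗ inc r (S ⊕ a)
    A≗ = inc-+ʳ r (len S) a

    mk : ∀ {x S⁺ a⁺ b r⁺} → Tbl M' S⁺ → Next (plain m) x S a S⁺ a⁺ → Next (plain m) x S (inc r a) S⁺ b →
         b ≗ inc r⁺ a⁺ → Tail S⁺ a⁺ r⁺ → Cell m (S ⊕ inc r a) (S⁺ ⊕ inc r⁺ a⁺) (S ⊕ a) (S⁺ ⊕ a⁺) →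
         Result₂ m (ext (plain m) S a) (ext (plain m) S (inc r a))
           (berIns (ext (plain m) S a) x) (berIns (ext (plain m) S (inc r a)) x)
    mk {x} {S⁺} {a⁺} {b} {r⁺} t n n' eq tl c
      rewrite Next.berIns-ext n | trans (Next.berIns-ext n') (ext-cong (plain m) S⁺ eq) =
      result₂ (phase₂ a⁺ lev t fits⁺ (Bounded-cong {plain m} (λ i → sym (eq i)) (Next.bnd⁺ n')) tl)
        (Cell-cong (len-ext (plain m) S _ fits) (len-ext (plain m) S⁺ _ fits⁺) (len-ext (plain m) S a fits')
          (len-ext (plain m) S⁺ a⁺ (Next.fits⁺ n)) c)
      where
      fits⁺ : Fits S⁺ (inc r⁺ a⁺)
      fits⁺ = Fits-mono {S⁺} {b} (λ i → ≤-reflexive (sym (eq i))) (Next.fits⁺ n')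

  phase₂-max : 1 ≤ m → Result₂ m (ext (plain m) S a) (ext (plain m) S (inc r a))
    (berIns (ext (plain m) S a) (plain m)) (berIns (ext (plain m) S (inc r a)) (plain m))
  phase₂-max 1≤m = mk tS (next-max lev tS a fits' bnd' 1≤m) (next-max lev tS (inc r a) fits bnd 1≤m)
    (inc-comm 0 r a) tail
    (grown 0 r (inc-+ʳ 0 (len S) a) (inc-+ʳ r (len S) (inc 0 a)) A≗)

  -- A plain m is never cancelled, so this phase does not end. The strips part only at the
  -- additional m, which then moves down from row r (`grown-next`) or up out of it (`shrunk-eq`).
  -- `Tail` forces any change that leaves the strip alone to happen above row r.
  phase₂-< : ∀ {x S'} → code x < code (plain m) → Tbl M' S' → Step M' x S S' →
    Result₂ m (ext (plain m) S a) (ext (plain m) S (inc r a))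
      (berIns (ext (plain m) S a) x) (berIns (ext (plain m) S (inc r a)) x)
  phase₂-< {x} {S'} x<M tS' (grow k y {R} ins tR k<y y≤ pl lenR lenS') with a k ≟ 0
  ... | no a≢0 = mk tS'
          (next-bump lev tS a fits' bnd' x<M tS' ins k<y y≤ lenS' a≢0 M≢)
          (next-bump lev tS (inc r a) fits bnd x<M tS' ins k<y y≤ lenS' (inc-≢0 r a a≢0) M≢)
          (λ i → trans (inc-cong (suc k) (dec-inc-comm k r a a≢0) i) (inc-comm (suc k) r (dec k a) i))
          tail⁺
          (grown (suc k) r (λ i → trans (inc-+ʳ (suc k) (len S') (dec k a) i) (inc-cong (suc k) lens i))
            (inc-+ʳ r (len S') a⁺) A≗)
    where
    a⁺ = inc (suc k) (dec k a)
    lens : ∀ i → len S' i + dec k a i ≡ len S i + a i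
    lens = inc-+-dec k a a≢0 lenS'
    tail⁺ : Tail S' a⁺ r
    tail⁺ i r≤i with i ≟ k | lens (suc i) | tail i r≤i
    ... | yes refl | l | t rewrite inc-at (suc i) (dec i a) | +-suc (len S' (suc i)) (dec i a (suc i)) | l | t | lenS' i | inc-at i (len S) = refl
    ... | no i≢k | l | t rewrite inc-off k (dec k a ∘ suc) i≢k | l | t | lenS' i | inc-off k (len S) i≢k = refl
  ... | yes a≡0 with k ≟ r
  ...   | yes refl = mk tS'
            (next-free lev tS a fits' bnd' x<M tS' ins tR k<y y≤ lenR lenS' a≡0)
            (next-bump lev tS (inc r a) fits bnd x<M tS' ins k<y y≤ lenS' (inc-at≢0 r a) M≢)
            (inc-cong (suc r) (dec-inc r a))
            tail⁺
            (grown-next r D≗ (inc-+ʳ (suc r) (len S') a) A≗ column)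
    where
    D≗ : (S' ⊕ a) ≗ inc r (S ⊕ a)
    D≗ i = trans (cong (_+ a i) (lenS' i)) (inc-+ˡ r (len S) a i)
    off : ∀ {i} → r < i → len S' i ≡ len S i
    off {i} r<i = trans (lenS' i) (inc-off r (len S) (>⇒≢ r<i))
    tail⁺ : Tail S' a (suc r)
    tail⁺ i r<i rewrite off r<i | off (m<n⇒m<1+n r<i) = tail i (<⇒≤ r<i)
    -- By `Tail` at r the new cells in rows r and r + 1 lie in one column: they form a vertical
    -- domino.
    column : (S' ⊕ inc (suc r) a) (suc r) ≡ (S' ⊕ a) r
    column rewrite inc-at (suc r) a | off (≤-refl {suc r}) | +-suc (len S (suc r)) (a (suc r)) | tail r ≤-refl
                 | lenS' r | inc-at r (len S) | a≡0 = sym (+-identityʳ _)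
  ...   | no k≢r = mk tS'
            (next-free lev tS a fits' bnd' x<M tS' ins tR k<y y≤ lenR lenS' a≡0)
            (next-free lev tS (inc r a) fits bnd x<M tS' ins tR k<y y≤ lenR lenS' (trans (inc-off r a k≢r) a≡0))
            (λ _ → refl)
            (λ i r≤i → trans (cong (_+ a (suc i)) (off (<-≤-trans k<r (m≤n⇒m≤1+n r≤i)))) (trans (tail i r≤i) (sym (off (<-≤-trans k<r r≤i)))))
            (grown k r (λ i → trans (cong (_+ a i) (lenS' i)) (inc-+ˡ k (len S) a i)) (inc-+ʳ r (len S') a) A≗)
    where
    off : ∀ {i} → k < i → len S' i ≡ len S i
    off {i} k<i = trans (lenS' i) (inc-off k (len S) (>⇒≢ k<i))
    -- Below row r the strip is as long as it can be, so a new cell there has an m on it.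
    full : ∀ k → len S' ≗ inc k (len S) → a k ≡ 0 → r < k → ⊥
    full (suc k) lenS' a≡0 r≤k = contradiction (tbl-antitone tS' k) (<⇒≱ (begin-strict
      len S' k                  ≡⟨ trans (lenS' k) (inc-off (suc k) (len S) (1+n≢n ∘ sym)) ⟩
      len S k                   ≡⟨ sym (tail k (s≤s⁻¹ r≤k)) ⟩
      len S (suc k) + a (suc k) ≡⟨ trans (cong (len S (suc k) +_) a≡0) (+-identityʳ _) ⟩
      len S (suc k)             <⟨ ≤-refl ⟩
      suc (len S (suc k))       ≡⟨ sym (trans (lenS' (suc k)) (inc-at (suc k) (len S))) ⟩
      len S' (suc k) ∎))
      where open ≤-Reasoning
    k<r : k < r
    k<r = ≤∧≢⇒< (≮⇒≥ λ r<k → full k lenS' a≡0 r<k) k≢r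
  phase₂-< {x} {S'} x<M tS' (shrink k can sl n≤ q< pr be lenS₁ lenS') with m≤n⇒m<n∨m≡n (fits' k)
  ... | inj₂ eq = mk tS'
          (next-jump lev tS a fits' bnd' x<M tS' can sl n≤ q< pr be lenS₁ lenS' eq)
          (next-jump lev tS (inc r a) fits bnd x<M tS' can sl n≤ q< pr be lenS₁ lenS'
            (trans (cong (len S (suc k) +_) (inc-off r a sk≢r)) eq))
          (λ i → trans (inc-cong k (dec-inc-comm (suc k) r a a≢0) i) (inc-comm k r (dec (suc k) a) i))
          tail⁺
          (shrunk (suc k) r sk≢r lens (inc-+ʳ r (len S') a⁺) A≗)
    where
    a⁺ = inc k (dec (suc k) a)
    a≢0 : a (suc k) ≢ 0
    a≢0 = jump⇒≢0 {k} {S} {S'} {a} lenS' (tbl-antitone tS' k) eq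
    -- Row k + 1 already reaches the end of row k of S, so there is no room in it for the additional
    -- m.
    sk≢r : suc k ≢ r
    sk≢r refl = <⇒≱ (≤-reflexive (trans (cong suc (sym eq)) (trans (sym (+-suc _ _)) (cong (len S (suc k) +_) (sym (inc-at (suc k) a)))))) (fits k)
    lens : (S ⊕ a) ≗ inc (suc k) (S' ⊕ a⁺)
    lens = inc-+-shift k a a≢0 lenS'
    tail⁺ : Tail S' a⁺ r
    tail⁺ i r≤i with i ≟ k | lens (suc i)
    ... | yes refl | l = suc-injective (trans (sym (trans l (inc-at (suc i) (S' ⊕ a⁺)))) (trans eq (trans (lenS' i) (inc-at i (len S')))))
    ... | no i≢k   | l = trans (sym (trans l (inc-off (suc k) (S' ⊕ a⁺) (i≢k ∘ suc-injective))))
                           (trans (tail i r≤i) (trans (lenS' i) (inc-off k (len S') i≢k)))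
  ... | inj₁ lt with m≤n⇒m<n∨m≡n (fits k)
  ...   | inj₁ lt' = mk tS'
            (next-slide lev tS a fits' bnd' x<M tS' can sl n≤ q< pr be lenS₁ lenS' lt)
            (next-slide lev tS (inc r a) fits bnd x<M tS' can sl n≤ q< pr be lenS₁ lenS' lt')
            (λ _ → refl)
            (λ i r≤i → trans (cong (_+ a (suc i)) (off (<-≤-trans k<r (m≤n⇒m≤1+n r≤i)))) (trans (tail i r≤i) (sym (off (<-≤-trans k<r r≤i)))))
            (shrunk k r (<⇒≢ k<r) C≗ (inc-+ʳ r (len S') a) A≗)
    where
    k<r : k < r
    k<r = ≰⇒> λ r≤k → <⇒≢ lt (tail k r≤k)
    off : ∀ {i} → k < i → len S' i ≡ len S i
    off {i} k<i = sym (trans (lenS' i) (inc-off k (len S') (>⇒≢ k<i)))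
    C≗ : (S ⊕ a) ≗ inc k (S' ⊕ a)
    C≗ i = trans (cong (_+ a i) (lenS' i)) (inc-+ˡ k (len S') a i)
  ...   | inj₂ eq with suc k ≟ r
  ...     | no sk≢r = contradiction (trans (cong (len S (suc k) +_) (sym (inc-off r a sk≢r))) eq) (<⇒≢ lt)
  ...     | yes refl = mk tS'
              (next-slide lev tS a fits' bnd' x<M tS' can sl n≤ q< pr be lenS₁ lenS' lt)
              (next-jump lev tS (inc r a) fits bnd x<M tS' can sl n≤ q< pr be lenS₁ lenS' eq)
              (inc-cong k (dec-inc (suc k) a))
              tail⁺
              (shrunk-eq k r<m C≗ (inc-+ʳ k (len S') a) A≗)
    where
    off : ∀ {i} → k < i → len S' i ≡ len S i
    off {i} k<i = sym (trans (lenS' i) (inc-off k (len S') (>⇒≢ k<i)))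
    C≗ : (S ⊕ a) ≗ inc k (S' ⊕ a)
    C≗ i = trans (cong (_+ a i) (lenS' i)) (inc-+ˡ k (len S') a i)
    -- The row condition for the additional m in row `suc k`. It is this bound that separates (Ya)
    -- from (○).
    r<m : suc k < m
    r<m = ≰⇒> λ m≤r → inc-at≢0 (suc k) a (bnd (suc k) m≤r)
    tail⁺ : Tail S' a k
    tail⁺ i k≤i with m≤n⇒m<n∨m≡n k≤i
    ... | inj₁ k<i rewrite off k<i | off (m<n⇒m<1+n k<i) = tail i k<i
    ... | inj₂ refl = suc-injective (begin
      suc (len S' (suc k) + a (suc k)) ≡⟨ sym (+-suc _ _) ⟩
      len S' (suc k) + suc (a (suc k)) ≡⟨ cong₂ _+_ (off ≤-refl) (sym (inc-at (suc k) a)) ⟩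
      len S (suc k) + inc (suc k) a (suc k) ≡⟨ eq ⟩
      len S k ≡⟨ trans (lenS' k) (inc-at k (len S')) ⟩
      suc (len S' k) ∎)
      where open ≡-Reasoning

phase₁-berIns : ∀ {M T T' x} → Phase₁ M T T' → 1 ≤ idx x → code x < code M →
  Result₁ M T (berIns T x) (berIns T' x)
phase₁-berIns {x = x} (phase₁ a lev tS fits bnd z) 1≤x x<M with tbl-step tS 1≤x (≤M' {x = x} lev x<M)
... | S' , st , tS' = phase₁-step lev tS a fits bnd z x<M tS' st

phase₂-berIns : ∀ {m T T' x} → Phase₂ m T T' → 1 ≤ idx x → code x ≤ code (plain m) →
  Result₂ m T T' (berIns T x) (berIns T' x)
phase₂-berIns {m} {x = x} (phase₂ a lev tS fits bnd tl) 1≤x x≤ with m≤n⇒m<n∨m≡n x≤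
... | inj₂ eq rewrite code-injective {x} {plain m} eq = phase₂-max lev tS a fits bnd tl 1≤x
... | inj₁ x<M with tbl-step tS 1≤x (≤M' {x = x} lev x<M)
... | S' , st , tS' = phase₂-< lev tS a fits bnd tl x<M tS' st

-- Shapes

pt : Shape → ℕ → ℕ
pt []      i       = 0
pt (x ∷ σ) zero    = x
pt (x ∷ σ) (suc i) = pt σ i

Pos : Shape → Set
Pos = All (_≢ 0)

Antitone : (ℕ → ℕ) → Set
Antitone f = ∀ i → f (suc i) ≤ f i

pt-shape : ∀ T → pt (shape T) ≗ len T
pt-shape []      i       = refl
pt-shape (r ∷ T) zero    = refl
pt-shape (r ∷ T) (suc i) = pt-shape T i

pos-shape : ∀ {T} → Proper T → Pos (shape T)
pos-shape []                = []
pos-shape {[] ∷ T}      (p ∷ ps) = contradiction refl p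
pos-shape {(x ∷ r) ∷ T} (p ∷ ps) = (λ ()) ∷ pos-shape ps

part-suc : ∀ σ k → part σ (suc k) ≡ pt σ k
part-suc []      k       = refl
part-suc (x ∷ σ) zero    = refl
part-suc (x ∷ σ) (suc k) = part-suc σ k

pt-injective : ∀ {σ τ} → Pos σ → Pos τ → pt σ ≗ pt τ → σ ≡ τ
pt-injective []       []       eq = refl
pt-injective []       (q ∷ qs) eq = contradiction (sym (eq 0)) q
pt-injective (p ∷ ps) []       eq = contradiction (eq 0) p
pt-injective (p ∷ ps) (q ∷ qs) eq = cong₂ _∷_ (eq 0) (pt-injective ps qs (eq ∘ suc))

inc⇒addCell : ∀ {σ τ} k → Pos σ → Pos τ → pt τ ≗ inc k (pt σ) → addCell (suc k) σ ≡ just τ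
inc⇒addCell zero [] [] eq = contradiction (eq 0) λ ()
inc⇒addCell zero [] (q ∷ qs) eq = cong just (sym (cong₂ _∷_ (eq 0) (pt-injective qs [] (eq ∘ suc))))
inc⇒addCell zero (p ∷ ps) [] eq = contradiction (eq 0) λ ()
inc⇒addCell zero (p ∷ ps) (q ∷ qs) eq = cong just (sym (cong₂ _∷_ (eq 0) (pt-injective qs ps (eq ∘ suc))))
inc⇒addCell (suc k) [] [] eq = contradiction (trans (eq (suc k)) (inc-at k _)) λ ()
inc⇒addCell (suc k) [] (q ∷ qs) eq = contradiction (eq 0) q
inc⇒addCell (suc k) (p ∷ ps) [] eq = contradiction (sym (eq 0)) p
inc⇒addCell {x ∷ σ} (suc k) (p ∷ ps) (q ∷ qs) eq
  rewrite inc⇒addCell k ps qs (eq ∘ suc) = cong (λ z → just (z ∷ _)) (sym (eq 0))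

addCell⇒inc : ∀ {σ τ} k → addCell (suc k) σ ≡ just τ → pt τ ≗ inc k (pt σ)
addCell⇒inc {[]}    zero refl zero    = refl
addCell⇒inc {[]}    zero refl (suc i) = refl
addCell⇒inc {x ∷ σ} zero refl zero    = refl
addCell⇒inc {x ∷ σ} zero refl (suc i) = refl
addCell⇒inc {x ∷ σ} (suc k) eq i with addCell (suc k) σ in eq'
addCell⇒inc {x ∷ σ} (suc k) refl zero    | just ρ = refl
addCell⇒inc {x ∷ σ} (suc k) refl (suc i) | just ρ = addCell⇒inc {σ} k eq' i

addCell⇒≤ : ∀ {σ τ} k → addCell (suc k) σ ≡ just τ → k ≤ length σ
addCell⇒≤ zero eq = z≤n
addCell⇒≤ {x ∷ σ} (suc k) eq with addCell (suc k) σ in eq'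
... | just ρ = s≤s (addCell⇒≤ {σ} k eq')

inc-injective : ∀ {j k f} → inc j f ≗ inc k f → j ≡ k
inc-injective {j} {k} {f} eq with j ≟ k
... | yes j≡k = j≡k
... | no j≢k  = contradiction (trans (sym (inc-at j f)) (trans (eq j) (inc-off k f j≢k))) 1+n≢n

eqShape-refl : ∀ σ → eqShape σ σ ≡ true
eqShape-refl []      = refl
eqShape-refl (x ∷ σ) rewrite ≡ᵇ-refl x = eqShape-refl σ

eqShape-sound : ∀ σ τ → eqShape σ τ ≡ true → σ ≡ τ
eqShape-sound []      []      eq = refl
eqShape-sound (x ∷ σ) (y ∷ τ) eq with x ≡ᵇ y in x≡y
... | true = cong₂ _∷_ (≡ᵇ⇒≡ x y (Equivalence.from T-≡ x≡y)) (eqShape-sound σ τ eq)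

¬true⇒false : ∀ {b : Bool} → b ≢ true → b ≡ false
¬true⇒false {false} b≢ = refl
¬true⇒false {true}  b≢ = contradiction refl b≢

eqMShape-sound : ∀ m τ → eqMShape m τ ≡ true → m ≡ just τ
eqMShape-sound (just σ) τ eq = cong just (eqShape-sound σ τ eq)

findFirst-applyUpTo : ∀ p (f : ℕ → ℕ) n k → k < n → p (f k) ≡ true → (∀ j → j < k → p (f j) ≡ false) →
  findFirst p (applyUpTo f n) ≡ just (f k)
findFirst-applyUpTo p f (suc n) zero    k<n pk below rewrite pk = refl
findFirst-applyUpTo p f (suc n) (suc k) k<n pk below rewrite below 0 z<s =
  findFirst-applyUpTo p (f ∘ suc) n k (s<s⁻¹ k<n) pk (λ j j<k → below (suc j) (s<s j<k))

findFirst-none : ∀ p (f : ℕ → ℕ) n → (∀ j → p (f j) ≡ false) → findFirst p (applyUpTo f n) ≡ nothing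
findFirst-none p f zero    never = refl
findFirst-none p f (suc n) never rewrite never 0 = findFirst-none p (f ∘ suc) n (never ∘ suc)

-- The search cannot stop earlier, since cells in different rows give different shapes, and the
-- range suffices, since a cell goes at most one row beyond the last.
coverRow-inc : ∀ {σ τ} k → Pos σ → Pos τ → pt τ ≗ inc k (pt σ) → coverRow σ τ ≡ just (suc k)
coverRow-inc {σ} {τ} k ps qs eq =
  trans (cong (findFirst _) (map-applyUpTo id suc (suc (length σ)))) $
  findFirst-applyUpTo (λ j → eqMShape (addCell j σ) τ) suc (suc (length σ)) k (s≤s (addCell⇒≤ {σ} k added))
    (trans (cong (λ m → eqMShape m τ) added) (eqShape-refl τ))
    (λ j j<k → ¬true⇒false λ e → <⇒≢ j<k (inc-injective
      (λ i → trans (sym (addCell⇒inc {σ} j (eqMShape-sound _ τ e) i)) (eq i))))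
  where
  added : addCell (suc k) σ ≡ just τ
  added = inc⇒addCell k ps qs eq

coverRow-none : ∀ {σ τ} → (∀ i → pt τ i ≤ pt σ i) → coverRow σ τ ≡ nothing
coverRow-none {σ} {τ} le =
  trans (cong (findFirst _) (map-applyUpTo id suc (suc (length σ)))) $
  findFirst-none (λ j → eqMShape (addCell j σ) τ) suc (suc (length σ))
    (λ j → ¬true⇒false λ e → <⇒≱ (≤-reflexive (sym (trans (addCell⇒inc {σ} j (eqMShape-sound _ τ e) j) (inc-at j (pt σ))))) (le j))

-- The backward test

-- Two distinct rows that both receive a cell in either order cannot do so in the same
-- column.
not-same-column : ∀ {A B C D k r} → Antitone (pt A) → Antitone (pt D) → pt D ≗ inc k (pt C) →
  pt B ≗ inc r (pt D) → pt A ≗ inc r (pt C) →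
  (pt D k ≡ᵇ pt B r) ∧ ((suc k ≡ᵇ r) ∨ (suc r ≡ᵇ k)) ≡ false
not-same-column {A} {B} {C} {D} {k} {r} anA anD D≗ B≗ A≗ with pt D k ≟ pt B r
... | no D≢B rewrite ≢⇒≡ᵇ-false D≢B = refl
... | yes D≡B with suc k ≟ r | suc r ≟ k
...   | no a | no b rewrite ≢⇒≡ᵇ-false a | ≢⇒≡ᵇ-false b = ∧-zeroʳ _
...   | yes refl | _ = contradiction (anA k) (<⇒≱ (begin-strict
        pt A k             ≡⟨ trans (A≗ k) (inc-off (suc k) (pt C) (1+n≢n ∘ sym)) ⟩
        pt C k             <⟨ ≤-refl ⟩
        suc (pt C k)       ≡⟨ sym (trans (D≗ k) (inc-at k (pt C))) ⟩
        pt D k             ≡⟨ D≡B ⟩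
        pt B (suc k)       ≡⟨ trans (B≗ (suc k)) (inc-at (suc k) (pt D)) ⟩
        suc (pt D (suc k)) ≡⟨ cong suc (trans (D≗ (suc k)) (inc-off k (pt C) 1+n≢n)) ⟩
        suc (pt C (suc k)) ≡⟨ sym (trans (A≗ (suc k)) (inc-at (suc k) (pt C))) ⟩
        pt A (suc k) ∎))
        where open ≤-Reasoning
...   | no _ | yes refl = contradiction (anD r) (<⇒≱ (begin-strict
        pt D r             <⟨ ≤-refl ⟩
        suc (pt D r)       ≡⟨ sym (trans (B≗ r) (inc-at r (pt D))) ⟩
        pt B r             ≡⟨ sym D≡B ⟩
        pt D (suc r) ∎))
        where open ≤-Reasoning
-- `grown` is (J), or (J̄) with a horizontal domino if k = r; `grown-next` is (J̄) with a vertical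
-- domino; `shrunk` is (W); `shrunk-eq` is (Ya), where `suc k < m` makes the condition of (○) fail.
cell⇒backStep : ∀ {m A B C D} → Pos A → Pos B → Pos C → Pos D → Antitone (pt A) → Antitone (pt D) →
  Cell m (pt A) (pt B) (pt C) (pt D) → ∃ λ c → c ≢ caseCirc × backStep (bar m) B C D ≡ just (c , A)
cell⇒backStep {m} {A} {B} {C} {D} pA pB pC pD anA anD (grown k r D≗ B≗ A≗)
  rewrite coverRow-inc r pD pB B≗
        | coverRow-none {D} {C} (λ i → ≤-trans (≤-inc k (pt C) i) (≤-reflexive (sym (D≗ i))))
        | coverRow-inc k pC pD D≗
        | part-suc D k | part-suc B r with k ≟ r
... | yes refl rewrite pt-injective pA pD (λ i → trans (A≗ i) (sym (D≗ i)))
    | B≗ k | inc-at k (pt D) | ≡ᵇ-refl k | ≡ᵇ-refl (pt D k) = caseJbar , (λ ()) , refl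
... | no k≢r rewrite ≢⇒≡ᵇ-false k≢r | not-same-column {A} {B} {C} {D} {k} {r} anA anD D≗ B≗ A≗ | inc⇒addCell r pC pA A≗ =
  caseJ , (λ ()) , refl
cell⇒backStep {m} {A} {B} {C} {D} pA pB pC pD anA anD (grown-next r D≗ B≗ A≗ column)
  rewrite coverRow-inc (suc r) pD pB B≗
        | coverRow-none {D} {C} (λ i → ≤-trans (≤-inc r (pt C) i) (≤-reflexive (sym (D≗ i))))
        | coverRow-inc r pC pD D≗
        | part-suc D r | part-suc B (suc r) | column
        | ≢⇒≡ᵇ-false {r} {suc r} (1+n≢n ∘ sym) | ≡ᵇ-refl (pt D r) | ≡ᵇ-refl r
        | pt-injective pA pD (λ i → trans (A≗ i) (sym (D≗ i))) = caseJbar , (λ ()) , refl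
cell⇒backStep {m} {A} {B} {C} {D} pA pB pC pD anA anD (shrunk k r k≢r C≗ B≗ A≗)
  rewrite coverRow-inc r pD pB B≗
        | coverRow-inc k pD pC C≗
        | ¬true⇒false {eqShape B C} (λ e → k≢r (sym (inc-injective {f = pt D} λ i →
            trans (sym (B≗ i)) (trans (cong (λ X → pt X i) (eqShape-sound B C e)) (C≗ i)))))
        | ≢⇒≡ᵇ-false k≢r
        | inc⇒addCell r pC pA A≗ = caseW , (λ ()) , refl
cell⇒backStep {m} {A} {B} {C} {D} pA pB pC pD anA anD (shrunk-eq k k<m C≗ B≗ A≗)
  with pt-injective pB pC (λ i → trans (B≗ i) (sym (C≗ i)))
... | refl
  rewrite coverRow-inc k pD pB B≗
        | coverRow-inc k pD pC C≗
        | eqShape-refl B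
        | ≤L-false (bar m) (bar (suc k)) (s<s (*-monoʳ-< 2 k<m))
        | inc⇒addCell (suc k) pC pA A≗ = caseYa , (λ ()) , refl

cell⇒cover : ∀ {m A B C D} → Cell m A B C D → ∃ λ k → B ≗ inc k D
cell⇒cover (grown k r _ B≗ _)        = r , B≗
cell⇒cover (grown-next r _ B≗ _ _)   = suc r , B≗
cell⇒cover (shrunk k r _ _ B≗ _)     = r , B≗
cell⇒cover (shrunk-eq k _ _ B≗ _)    = k , B≗

isCover-inc : ∀ {σ τ} k → Pos σ → Pos τ → pt τ ≗ inc k (pt σ) → isCover σ τ ≡ true
isCover-inc k ps qs eq rewrite coverRow-inc k ps qs eq = refl

runTest-step : ∀ {γ σ κ κ' A c} rest → isCover κ σ ≡ true → c ≢ caseCirc → backStep γ σ κ' κ ≡ just (c , A) →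
  runTest γ σ (κ ∷ κ' ∷ rest) ≡ runTest γ A (κ' ∷ rest)
runTest-step {c = caseCirc} rest cov c≢ eq = contradiction refl c≢
runTest-step {c = caseYa}   rest cov c≢ eq rewrite cov | eq = refl
runTest-step {c = caseW}    rest cov c≢ eq rewrite cov | eq = refl
runTest-step {c = caseJbar} rest cov c≢ eq rewrite cov | eq = refl
runTest-step {c = caseJ}    rest cov c≢ eq rewrite cov | eq = refl

cell⇒runTest : ∀ {m A B C D} rest → Pos A → Pos B → Pos C → Pos D → Antitone (pt A) → Antitone (pt D) →
  Cell m (pt A) (pt B) (pt C) (pt D) →
  runTest (bar m) B (D ∷ C ∷ rest) ≡ runTest (bar m) A (C ∷ rest)
cell⇒runTest {m} {A} {B} {C} {D} rest pA pB pC pD anA anD cell with cell⇒cover cell | cell⇒backStep pA pB pC pD anA anD cell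
... | k , B≗ | c , c≢ , eq = runTest-step {bar m} {B} {D} {C} {A} {c} rest (isCover-inc k pD pB B≗) c≢ eq

-- The borderline of the condition of (○): the removed cell lies in row `suc r`, counted from 1, and
-- the stratum has the same index.
circle-backStep : ∀ {C D} r → Pos C → Pos D → pt C ≗ inc r (pt D) →
  backStep (bar (suc r)) C C D ≡ just (caseCirc , D)
circle-backStep {C} r pC pD C≗
  rewrite coverRow-inc r pD pC C≗ | coverRow-inc r pD pC C≗ | eqShape-refl C | ≤L-true (bar (suc r)) (bar (suc r)) ≤-refl = refl

circle⇒runTest : ∀ {B C D} r rest → Pos B → Pos C → Pos D → pt B ≗ pt C → pt C ≗ inc r (pt D) →
  runTest (bar (suc r)) B (D ∷ C ∷ rest) ≡ circle
circle⇒runTest r rest pB pC pD B≗ C≗ with pt-injective pB pC B≗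
... | refl rewrite isCover-inc r pD pC C≗ | circle-backStep r pC pD C≗ = refl

==L-refl : ∀ x → (x ==L x) ≡ true
==L-refl (plain k) = ≡ᵇ-refl k
==L-refl (bar k)   = ≡ᵇ-refl k

==L-sound : ∀ x y → (x ==L y) ≡ true → x ≡ y
==L-sound (plain a) (plain b) eq = cong plain (≡ᵇ⇒≡ a b (Equivalence.from T-≡ eq))
==L-sound (bar a)   (bar b)   eq = cong bar (≡ᵇ⇒≡ a b (Equivalence.from T-≡ eq))

==L-false : ∀ {x y} → x ≢ y → (x ==L y) ≡ false
==L-false {x} {y} x≢y = ¬true⇒false (x≢y ∘ ==L-sound x y)

<⇒≢L : ∀ {x y} → code x < code y → x ≢ y
<⇒≢L lt refl = <-irrefl refl lt

antitone-≤ : ∀ {f} → Antitone f → ∀ {i j} → i ≤ j → f j ≤ f i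
antitone-≤ {f} anti {i} {j} i≤j with m≤n⇒∃[o]m+o≡n i≤j
... | d , refl = go d
  where
  go : ∀ d → f (i + d) ≤ f i
  go zero    = ≤-reflexive (cong f (+-identityʳ i))
  go (suc d) = ≤-trans (≤-reflexive (cong f (+-suc i d))) (≤-trans (anti (i + d)) (go d))

-- The tableau P̄

columnHas-true : ∀ T i {j x} → get T i j ≡ just x → columnHas T j x ≡ true
columnHas-true (r ∷ T) zero {j} {x} eq rewrite eq | ==L-refl x = refl
columnHas-true (r ∷ T) (suc i) {j} {x} eq with nth r j
... | nothing = columnHas-true T i eq
... | just y rewrite columnHas-true T i eq = ∨-zeroʳ _

columnHas-false : ∀ T {j x} → (∀ i → get T i j ≢ just x) → columnHas T j x ≡ false
columnHas-false [] none = refl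
columnHas-false (r ∷ T) {j} {x} none with nth r j in eq
... | nothing = columnHas-false T (none ∘ suc)
... | just y rewrite ==L-false {y} {x} (λ { refl → none 0 eq }) = columnHas-false T (none ∘ suc)

<-get : ∀ T i j → j < len T i → ∃ λ b → get T i j ≡ just b
<-get T i j lt with get T i j in eq
... | just b  = b , refl
... | nothing = contradiction lt (≤⇒≯ (get-≥ T i j eq))

colHeight-≡ : ∀ T {j} r → (∀ i → i < r → j < len T i) → (∀ i → r ≤ i → len T i ≤ j) → colHeight T j ≡ r
colHeight-≡ [] zero    above below = refl
colHeight-≡ [] (suc r) above below = contradiction (above 0 z<s) λ ()
colHeight-≡ (s ∷ T) {j} zero above below with j <ᵇ length s in eq
... | true  = contradiction (below 0 z≤n) (<⇒≱ (<ᵇ⇒< _ _ (Equivalence.from T-≡ eq)))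
... | false = colHeight-≡ T zero (λ i ()) (λ i _ → below (suc i) z≤n)
colHeight-≡ (s ∷ T) {j} (suc r) above below
  rewrite Equivalence.to (T-≡ {j <ᵇ length s}) (<⇒<ᵇ (above 0 z<s)) =
  cong suc (colHeight-≡ T r (λ i i<r → above (suc i) (s<s i<r)) (λ i r≤i → below (suc i) (s≤s r≤i)))

firstRowLength-len : ∀ T → firstRowLength T ≡ len T 0
firstRowLength-len []      = refl
firstRowLength-len (r ∷ T) = refl

appendToRow-ext : ∀ M S a k → Fits S (inc k a) → appendToRow (ext M S a) k M ≡ ext M S (inc k a)
appendToRow-ext M [] a (suc k) fits =
  contradiction (≤-trans (≤-reflexive (sym (inc-at k (a ∘ suc)))) (fits k)) λ ()
appendToRow-ext M [] a zero fits with a 0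
... | zero  = refl
... | suc n = cong (_∷ []) (replicate-∷ʳ M (suc n))
appendToRow-ext M (r ∷ S) a zero    fits =
  cong (_∷ _) (trans (++-assoc r _ _) (cong (r ++_) (replicate-∷ʳ M (a 0))))
appendToRow-ext M (r ∷ S) a (suc k) fits =
  cong (_ ∷_) (appendToRow-ext M S (a ∘ suc) k (Fits-tail {r} {S} {inc (suc k) a} fits))

-- The column sought is the one just after row r of P. Above row r it contains letters of S, because
-- there is room for the additional m; from row r on it is empty. By `Tail` every column to its left
-- contains an m.
Pbar-correct : ∀ {m T T'} → Phase₂ m T T' → Pbar m T ≡ T'
Pbar-correct {m} (phase₂ {M'} {S} {r} a lev tS fits bnd tail) = main
  where
  M = plain m
  P = ext M S a
  fits' : Fits S a
  fits' = Fits-mono {S} {inc r a} (≤-inc r a) fits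
  bnd' : Bounded M a
  bnd' = Bounded-mono {M} (≤-inc r a) bnd
  tP : Tbl M P
  tP = level a lev tS fits' bnd'
  lenP : len P ≗ (S ⊕ a)
  lenP = len-ext M S a fits'
  col = len P r
  above : ∀ i → i < r → col < len S i
  above i i<r = go r fits (≤-reflexive (lenP r)) i<r
    where
    go : ∀ r → Fits S (inc r a) → col ≤ len S r + a r → i < r → col < len S i
    go (suc r) fits col≤ (s≤s i≤r) = <-≤-trans (≤-<-trans col≤ (≤-trans (≤-reflexive (trans (sym (+-suc _ _))
      (cong (len S (suc r) +_) (sym (inc-at (suc r) a))))) (fits r))) (antitone-≤ (tbl-antitone tS) i≤r)
  below : ∀ i → r ≤ i → len P i ≤ col
  below i r≤i = antitone-≤ (tbl-antitone tP) r≤i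
  no-M : ∀ i → get P i col ≢ just M
  no-M i eq with <-≤-connex i r
  ... | inj₂ r≤i = contradiction (get-< P i col eq) (≤⇒≯ (below i r≤i))
  ... | inj₁ i<r with <-get S i col (above i i<r)
  ... | b , eq' with just-injective (trans (sym (ext-get M S a i col eq')) eq)
  ... | refl = <-irrefl refl (get-below S i col eq' (tbl-below-⋖ lev tS))
  -- Descent from row r: either column j is past row i of S and meets the strip there, or `Tail`
  -- continues it into row i + 1 of P. Rows from m on are empty, so d bounds the number of steps.
  has-M : ∀ d i j → r ≤ i → m ≤ i + d → j < len P i → columnHas P j M ≡ true
  has-M d i j r≤i m≤ lt with <-≤-connex j (len S i)
  ... | inj₂ S≤j = columnHas-true P i (get-ext-M M S a i j fits' S≤j (subst (j <_) (lenP i) lt))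
  has-M zero i j r≤i m≤ lt | inj₁ j<S =
    contradiction (subst (j <_) (tbl-rows tP i (≤-trans m≤ (≤-reflexive (+-identityʳ i)))) lt) λ ()
  has-M (suc d) i j r≤i m≤ lt | inj₁ j<S =
    has-M d (suc i) j (m≤n⇒m≤1+n r≤i) (≤-trans m≤ (≤-reflexive (+-suc i d)))
      (subst (j <_) (sym (trans (lenP (suc i)) (tail i r≤i))) j<S)
  found : findFirst (λ j → not (columnHas P j M)) (upTo (suc (firstRowLength P))) ≡ just col
  found = findFirst-applyUpTo _ id (suc (firstRowLength P)) col
    (s≤s (≤-trans (antitone-≤ (tbl-antitone tP) z≤n) (≤-reflexive (sym (firstRowLength-len P)))))
    (cong not (columnHas-false P no-M))
    (λ j j<col → cong not (has-M m r j ≤-refl (m≤n+m m r) j<col))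
  main : Pbar m P ≡ ext M S (inc r a)
  main rewrite found | colHeight-≡ P r
      (λ i i<r → <-≤-trans (above i i<r) (≤-trans (m≤m+n _ (a i)) (≤-reflexive (sym (lenP i))))) below =
    appendToRow-ext M S a r fits

-- The rightmost occurrence of the largest letter

lastFrom : Letter → ℕ → List Letter → Maybe ℕ → Maybe ℕ
lastFrom x i []       acc = acc
lastFrom x i (y ∷ ys) acc = lastFrom x (suc i) ys (if y ==L x then just i else acc)

-- The underscore stands for the function go local to lastOcc, which has no name outside
-- of Defs; unification finds it in the lemma after.  The same device is used for
-- rightmostOcc, deleteLast and berP.
mutual
  lastOcc-go : ∀ x r i acc → _ ≡ lastFrom x i r acc
  lastOcc≡lastFrom : ∀ x r → lastOcc x r ≡ lastFrom x 0 r nothing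
  lastOcc≡lastFrom x r with 0 | nothing {A = ℕ}
  ... | i | acc = lastOcc-go x r i acc
  lastOcc-go x []      i acc = refl
  lastOcc-go x (y ∷ r) i acc = lastOcc-go x r (suc i) _

lastFrom-skip : ∀ M i r s acc → All (λ y → code y < code M) r → lastFrom M i (r ++ s) acc ≡ lastFrom M (length r + i) s acc
lastFrom-skip M i []      s acc []       = refl
lastFrom-skip M i (y ∷ r) s acc (p ∷ ps) rewrite ==L-false (<⇒≢L {y} {M} p) =
  trans (lastFrom-skip M (suc i) r s acc ps) (cong (λ n → lastFrom M n s acc) (+-suc (length r) i))

lastFrom-replicate : ∀ M i n acc → lastFrom M i (replicate (suc n) M) acc ≡ just (i + n)
lastFrom-replicate M i zero    acc rewrite ==L-refl M | +-identityʳ i = refl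
lastFrom-replicate M i (suc n) acc = trans (lastFrom-replicate M (suc i) n _) (cong just (sym (+-suc i n)))

lastOcc-none : ∀ M r → All (λ y → code y < code M) r → lastOcc M (r ++ []) ≡ nothing
lastOcc-none M r ps = trans (lastOcc≡lastFrom M (r ++ [])) (lastFrom-skip M 0 r [] nothing ps)

lastOcc-some : ∀ M r n → All (λ y → code y < code M) r → lastOcc M (r ++ replicate (suc n) M) ≡ just (length r + n)
lastOcc-some M r n ps = trans (lastOcc≡lastFrom M (r ++ replicate (suc n) M))
  (trans (lastFrom-skip M 0 r _ nothing ps)
    (trans (lastFrom-replicate M (length r + 0) n nothing) (cong (λ k → just (k + n)) (+-identityʳ _))))

improve : ℕ → ℕ → Maybe (ℕ × ℕ) → Maybe (ℕ × ℕ)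
improve i j nothing          = just (i , j)
improve i j (just (i' , j')) = if j' <ᵇ j then just (i , j) else just (i' , j')

scan : Letter → ℕ → Tab → Maybe (ℕ × ℕ) → Maybe (ℕ × ℕ)
scan x i []       acc = acc
scan x i (r ∷ rs) acc with lastOcc x r
... | nothing = scan x (suc i) rs acc
... | just j  = scan x (suc i) rs (improve i j acc)

mutual
  rightmostOcc-go : ∀ x T i acc → _ ≡ scan x i T acc
  rightmostOcc≡scan : ∀ x T → rightmostOcc x T ≡ scan x 0 T nothing
  rightmostOcc≡scan x T with 0 | nothing {A = ℕ × ℕ}
  ... | i | acc = rightmostOcc-go x T i acc
  rightmostOcc-go x []      i acc = refl
  rightmostOcc-go x (r ∷ T) i acc with lastOcc x r
  ... | nothing = rightmostOcc-go x T (suc i) acc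
  rightmostOcc-go x (r ∷ T) i nothing | just j = rightmostOcc-go x T (suc i) (just (i , j))
  rightmostOcc-go x (r ∷ T) i (just (i' , j')) | just j with j' <ᵇ j
  ... | true  = rightmostOcc-go x T (suc i) (just (i , j))
  ... | false = rightmostOcc-go x T (suc i) (just (i' , j'))

improve-keep : ∀ i j {i' j'} → j ≤ j' → improve i j (just (i' , j')) ≡ just (i' , j')
improve-keep i j {i'} {j'} le with j' <ᵇ j in eq
... | false = refl
... | true  = contradiction (<ᵇ⇒< j' j (Equivalence.from T-≡ eq)) (≤⇒≯ le)

module _ (M : Letter) where

  scan-keep : ∀ i {S} a {i' j'} → Below (code M) S → (∀ k → len S k + a k ≤ suc j') →
    scan M i (ext M S a) (just (i' , j')) ≡ just (i' , j')
  scan-keep i a {i'} {j'} [] le with a 0 | le 0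
  ... | zero  | _ = refl
  ... | suc n | s≤s n≤ rewrite lastOcc-some M [] n [] = improve-keep i n n≤
  scan-keep i {r ∷ S} a {i'} {j'} (b ∷ bs) le with a 0 | le 0
  ... | zero  | _ rewrite lastOcc-none M r b = scan-keep (suc i) (a ∘ suc) bs (le ∘ suc)
  ... | suc n | le₀ rewrite lastOcc-some M r n b
                          | improve-keep i (length r + n) {i'} {j'} (s≤s⁻¹ (≤-trans (≤-reflexive (sym (+-suc (length r) n))) le₀)) =
    scan-keep (suc i) (a ∘ suc) bs (le ∘ suc)

  -- Row r is the first with an M. In a horizontal strip each lower row ends within the row of S
  -- above it, so no later M lies further right and the first find is kept.
  scan-find : ∀ i {S} a r n → Below (code M) S → Fits S a → Antitone (len S) → ZeroBelow r a → a r ≡ suc n →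
    scan M i (ext M S a) nothing ≡ just (i + r , len S r + n)
  scan-find i a zero n [] fits anti z a≡ rewrite a≡ | lastOcc-some M [] n [] | +-identityʳ i = refl
  scan-find i a (suc r) n [] fits anti z a≡ = contradiction (trans (sym a≡) (Fits[]⇒0 {a} fits r)) λ ()
  scan-find i {s ∷ S} a zero n (b ∷ bs) fits anti z a≡
    rewrite a≡ | lastOcc-some M s n b | +-identityʳ i =
    scan-keep (suc i) (a ∘ suc) bs (λ k → ≤-trans (fits k) (≤-trans (antitone-≤ anti (z≤n {k})) (m≤n⇒m≤1+n (m≤m+n (length s) n))))
  scan-find i {s ∷ S} a (suc r) n (b ∷ bs) fits anti z a≡
    rewrite z 0 z<s | lastOcc-none M s b | +-suc i r =
    scan-find (suc i) (a ∘ suc) r n bs (Fits-tail {s} {S} {a} fits) (anti ∘ suc) (λ k k<r → z (suc k) (s<s k<r)) a≡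

deleteRightmost-correct : ∀ {M T T'} → Phase₁ M T T' → deleteRightmost M T ≡ T'
deleteRightmost-correct {M} (phase₁ {S = S} {r} a lev tS fits bnd z)
  rewrite trans (rightmostOcc≡scan M (ext M S (inc r a)))
            (scan-find M 0 (inc r a) r (a r) (tbl-below-⋖ lev tS) fits (tbl-antitone tS)
              (λ i i<r → trans (inc-off r a (<⇒≢ i<r)) (z i i<r)) (inc-at r a)) =
  trans (deleteCell-ext M (inc r a) r (len S r + a r) (tbl-proper tS) fits (m≤m+n _ _)
          (trans (sym (+-suc _ _)) (cong (len S r +_) (sym (inc-at r a)))))
        (ext-cong M S (dec-inc r a))

-- Largest letters of words

largest-∈ : ∀ xs {y} → largest xs ≡ just y → y ∈ xs
largest-∈ (x ∷ xs) eq with largest xs in eq'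
largest-∈ (x ∷ xs) refl | nothing = here refl
largest-∈ (x ∷ xs) eq   | just z with x ≤L z
largest-∈ (x ∷ xs) refl | just z | true  = there (largest-∈ xs eq')
largest-∈ (x ∷ xs) refl | just z | false = here refl

largest-nothing : ∀ xs → largest xs ≡ nothing → xs ≡ []
largest-nothing []       eq = refl
largest-nothing (x ∷ xs) eq with largest xs
largest-nothing (x ∷ xs) () | nothing
largest-nothing (x ∷ xs) () | just _

largest-≤ : ∀ xs {y} → largest xs ≡ just y → All (λ x → code x ≤ code y) xs
largest-≤ (x ∷ xs) eq with largest xs in eq'
largest-≤ (x ∷ xs) refl | nothing rewrite largest-nothing xs eq' = ≤-refl ∷ []
largest-≤ (x ∷ xs) eq   | just z with code x ≤ᵇ code z in x≤z
largest-≤ (x ∷ xs) refl | just z | true  = ≤ᵇ⇒≤ _ _ (Equivalence.from T-≡ x≤z) ∷ largest-≤ xs eq'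
largest-≤ (x ∷ xs) refl | just z | false =
  ≤-refl ∷ All.map (λ p → ≤-trans p (≰⇒≥ z≰x)) (largest-≤ xs eq')
  where
  z≰x : ¬ code x ≤ code z
  z≰x le with trans (sym x≤z) (Equivalence.to T-≡ (≤⇒≤ᵇ le))
  ... | ()

split-last : ∀ M w → All (λ x → code x ≤ code M) w → All (λ x → code x < code M) w ⊎
  ∃₂ λ u v → w ≡ u ++ M ∷ v × All (λ x → code x < code M) v
split-last M []      []       = inj₁ []
split-last M (x ∷ w) (p ∷ ps) with split-last M w ps
... | inj₂ (u , v , refl , v<M) = inj₂ (x ∷ u , v , refl , v<M)
... | inj₁ w<M with m≤n⇒m<n∨m≡n p
...   | inj₁ x<M = inj₁ (x<M ∷ w<M)
...   | inj₂ x≡M rewrite code-injective {x} {M} x≡M = inj₂ ([] , w , refl , w<M)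

removeFirst : Letter → List Letter → List Letter
removeFirst x []       = []
removeFirst x (y ∷ ys) = if y ==L x then ys else y ∷ removeFirst x ys

mutual
  deleteLast-go : ∀ x w ys → _ ≡ removeFirst x ys
  deleteLast≡removeFirst : ∀ x w → deleteLast x w ≡ reverse (removeFirst x (reverse w))
  deleteLast≡removeFirst x w with reverse {A = Letter}
  ... | f with f w
  ... | ys = cong f (deleteLast-go x w ys)
  deleteLast-go x w []       = refl
  deleteLast-go x w (y ∷ ys) rewrite deleteLast-go x w ys = refl

removeFirst-++ : ∀ M r s → All (λ x → code x < code M) r → removeFirst M (r ++ M ∷ s) ≡ r ++ s
removeFirst-++ M []      s []       rewrite ==L-refl M = refl
removeFirst-++ M (y ∷ r) s (p ∷ ps) rewrite ==L-false (<⇒≢L {y} {M} p) = cong (y ∷_) (removeFirst-++ M r s ps)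

deleteLast-split : ∀ M u v → All (λ x → code x < code M) v → deleteLast M (u ++ M ∷ v) ≡ u ++ v
deleteLast-split M u v v<M = begin
  deleteLast M (u ++ M ∷ v)                             ≡⟨ deleteLast≡removeFirst M (u ++ M ∷ v) ⟩
  reverse (removeFirst M (reverse (u ++ M ∷ v)))        ≡⟨ cong (reverse ∘ removeFirst M) reversed ⟩
  reverse (removeFirst M (reverse v ++ M ∷ reverse u))  ≡⟨ cong reverse (removeFirst-++ M (reverse v) (reverse u) (All-resp-↭ (↭-sym (↭-reverse v)) v<M)) ⟩
  reverse (reverse v ++ reverse u)                      ≡⟨ cong reverse (sym (reverse-++ u v)) ⟩
  reverse (reverse (u ++ v))                            ≡⟨ reverse-involutive (u ++ v) ⟩
  u ++ v                                                ∎
  where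
  open ≡-Reasoning
  reversed : reverse (u ++ M ∷ v) ≡ reverse v ++ M ∷ reverse u
  reversed = trans (reverse-++ u (M ∷ v))
    (trans (cong (_++ reverse u) (unfold-reverse M v)) (++-assoc (reverse v) (M ∷ []) (reverse u)))

dropLargest-split : ∀ M u v → largest (u ++ M ∷ v) ≡ just M → All (λ x → code x < code M) v →
  dropLargest (u ++ M ∷ v) ≡ u ++ v
dropLargest-split M u v eq v<M rewrite eq = deleteLast-split M u v v<M

-- Runs of the correspondence

mutual
  berP-go : ∀ x T xs → _ ≡ foldl berIns T xs
  berP-∷ : ∀ x xs → berP (x ∷ xs) ≡ foldl berIns [] (x ∷ xs)
  berP-∷ x xs with berIns [] x
  ... | T = berP-go x T xs
  berP-go x T []       = refl
  berP-go x T (y ∷ ys) = berP-go x (berIns T y) ys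

berP≡foldl : ∀ w → berP w ≡ foldl berIns [] w
berP≡foldl []      = refl
berP≡foldl (x ∷ w) = berP-∷ x w

-- The test reads the shapes from the last to the first. With the earlier shapes accumulated in
-- `hist`, one more insertion just puts a new head on the list, which allows induction forwards
-- along the word.
revTrace : List Shape → Tab → List Letter → List Shape
revTrace hist T []      = shape T ∷ hist
revTrace hist T (x ∷ v) = revTrace (shape T ∷ hist) (berIns T x) v

reverse-trace : ∀ hist T v → foldl (λ ys y → y ∷ ys) hist (map shape (tabsFrom T v)) ≡ revTrace hist T v
reverse-trace hist T []      = refl
reverse-trace hist T (x ∷ v) = reverse-trace (shape T ∷ hist) (berIns T x) v

revTrace-++ : ∀ hist T u v → ∃ λ hist' → revTrace hist T (u ++ v) ≡ revTrace hist' (foldl berIns T u) v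
revTrace-++ hist T []      v = hist , refl
revTrace-++ hist T (x ∷ u) v = revTrace-++ (shape T ∷ hist) (berIns T x) u v

trace : Tab → List Letter → List Shape
trace T v = map shape (tabsFrom T v)

HasRemoval-∷ : ∀ {l κ Q} → HasRemovalInRow l Q → HasRemovalInRow l (κ ∷ Q)
HasRemoval-∷ {Q = κ ∷ Q} any = there any

HasRemoval-++ : ∀ {l} T u v → HasRemovalInRow l (trace (foldl berIns T u) v) → HasRemovalInRow l (trace T (u ++ v))
HasRemoval-++ T []      v rem = rem
HasRemoval-++ {l} T (x ∷ u) v rem = HasRemoval-∷ {l} {shape T} (HasRemoval-++ {l} (berIns T x) u v rem)

maxℓ-++ : ∀ T u v → maxℓ (trace (foldl berIns T u) v) ≤ maxℓ (trace T (u ++ v))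
maxℓ-++ T []      v = ≤-refl
maxℓ-++ T (x ∷ u) v = ≤-trans (maxℓ-++ (berIns T x) u v) (m≤n⊔m _ _)

ℓ≤maxℓ : ∀ T v → ℓ (shape T) ≤ maxℓ (trace T v)
ℓ≤maxℓ T []      = m≤m⊔n _ _
ℓ≤maxℓ T (x ∷ v) = m≤m⊔n _ _

ℓ-pos : ∀ {σ} → Pos σ → ℓ σ ≡ length σ
ℓ-pos {[]}        []       = refl
ℓ-pos {zero ∷ σ}  (p ∷ ps) = contradiction refl p
ℓ-pos {suc _ ∷ σ} (p ∷ ps) = cong suc (ℓ-pos ps)

pt≢0⇒<ℓ : ∀ {σ} i → Pos σ → pt σ i ≢ 0 → i < ℓ σ
pt≢0⇒<ℓ {σ} i ps p rewrite ℓ-pos ps = go σ i p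
  where
  go : ∀ σ i → pt σ i ≢ 0 → i < length σ
  go []      i       p = contradiction refl p
  go (x ∷ σ) zero    p = z<s
  go (x ∷ σ) (suc i) p = s<s (go σ i p)

pt≡0⇒ℓ≤ : ∀ {σ i} → Pos σ → pt σ i ≡ 0 → ℓ σ ≤ i
pt≡0⇒ℓ≤ {σ} {i} ps p rewrite ℓ-pos ps = go i ps p
  where
  go : ∀ {σ} i → Pos σ → pt σ i ≡ 0 → length σ ≤ i
  go i       []       e = z≤n
  go zero    (p ∷ ps) e = contradiction e p
  go (suc i) (p ∷ ps) e = s≤s (go i ps e)

tbl-ℓ : ∀ {M T} → Tbl M T → ℓ (shape T) ≤ idx M
tbl-ℓ {M} {T} t = pt≡0⇒ℓ≤ (pos-shape (tbl-proper t)) (trans (pt-shape T (idx M)) (tbl-rows t (idx M) ≤-refl))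

-- The upper bound l ≤ idx M; a cancellation provides the opposite inequality.
maxℓ-bound : ∀ {M T} v → Tbl M T → All (λ x → 1 ≤ idx x × code x ≤ code M) v → maxℓ (trace T v) ≤ idx M
maxℓ-bound []      t []                = ⊔-lub (tbl-ℓ t) z≤n
maxℓ-bound (x ∷ v) t ((1≤x , x≤) ∷ ps) = ⊔-lub (tbl-ℓ t) (maxℓ-bound v (tbl-berIns t 1≤x x≤) ps)

tbl-run : ∀ {M T} v → Tbl M T → All (λ x → 1 ≤ idx x × code x ≤ code M) v → Tbl M (foldl berIns T v)
tbl-run []      t []                = t
tbl-run (x ∷ v) t ((1≤x , x≤) ∷ ps) = tbl-run v (tbl-berIns t 1≤x x≤) ps

phase₁-tbl : ∀ {M T T'} → Phase₁ M T T' → Tbl M T × Tbl M T'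
phase₁-tbl {M} (phase₁ {S = S} {r} a lev tS fits bnd z) =
  level (inc r a) lev tS fits bnd ,
  level a lev tS (Fits-mono {S} {inc r a} (≤-inc r a) fits) (Bounded-mono {M} (≤-inc r a) bnd)

phase₂-tbl : ∀ {m T T'} → Phase₂ m T T' → Tbl (plain m) T × Tbl (plain m) T'
phase₂-tbl {m} (phase₂ {S = S} {r} a lev tS fits bnd tl) =
  level a lev tS (Fits-mono {S} {inc r a} (≤-inc r a) fits) (Bounded-mono {plain m} (≤-inc r a) bnd) ,
  level (inc r a) lev tS fits bnd

phase₁-len : ∀ {M T T'} → Phase₁ M T T' → ∃ λ r → len T ≗ inc r (len T')
phase₁-len {M} (phase₁ {S = S} {r} a lev tS fits bnd z) =
  r , λ i → trans (len-ext M S (inc r a) fits i) (trans (inc-+ʳ r (len S) a i)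
    (inc-cong r (λ j → sym (len-ext M S a (Fits-mono {S} {inc r a} (≤-inc r a) fits) j)) i))

phase₂-len : ∀ {m T T'} → Phase₂ m T T' → ∃ λ r → len T' ≗ inc r (len T)
phase₂-len {m} (phase₂ {S = S} {r} a lev tS fits bnd tl) =
  r , λ i → trans (len-ext (plain m) S (inc r a) fits i) (trans (inc-+ʳ r (len S) a i)
    (inc-cong r (λ j → sym (len-ext (plain m) S a (Fits-mono {S} {inc r a} (≤-inc r a) fits) j)) i))

get-∈ : ∀ T i j {x} → get T i j ≡ just x → x ∈ concat T
get-∈ (r ∷ T) zero    j eq = ∈-++⁺ˡ (nth-∈ r j eq)
  where
  nth-∈ : ∀ r j {x} → nth r j ≡ just x → x ∈ r
  nth-∈ (y ∷ r) zero    refl = here refl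
  nth-∈ (y ∷ r) (suc j) eq   = there (nth-∈ r j eq)
get-∈ (r ∷ T) (suc i) j eq = ∈-++⁺ʳ r (get-∈ T i j eq)

phase₁-∈ : ∀ {M T T'} → Phase₁ M T T' → M ∈ concat T
phase₁-∈ {M} (phase₁ {S = S} {r} a lev tS fits bnd z) = get-∈ (ext M S (inc r a)) r (len S r)
  (get-ext-M M S (inc r a) r (len S r) fits ≤-refl (m<m+n (len S r) (n≢0⇒n>0 (inc-at≢0 r a))))

tbl-letters : ∀ {M T x} → Tbl M T → x ∈ concat T → code x ≤ code M
tbl-letters t x∈ = s≤s⁻¹ (All.lookup (All.concat⁺ (tbl-below t)) x∈)

tbl-pos : ∀ {M T} → Tbl M T → Pos (shape T)
tbl-pos = pos-shape ∘ tbl-proper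

tbl-anti : ∀ {M T} → Tbl M T → Antitone (pt (shape T))
tbl-anti {T = T} t i rewrite pt-shape T i | pt-shape T (suc i) = tbl-antitone t i

UpTo Under : Letter → Letter → Set
UpTo  M x = 1 ≤ idx x × code x ≤ code M
Under M x = 1 ≤ idx x × code x < code M

-- Each insertion adds one cell of the growth diagram, which the test crosses in one step. The test
-- begun after v therefore comes down to the test begun before v, whatever shapes precede.
run₂ : ∀ {m T T'} v hist → Phase₂ m T T' → All (UpTo (plain m)) v →
  Phase₂ m (foldl berIns T v) (foldl berIns T' v) ×
  runTest (bar m) (shape (foldl berIns T' v)) (revTrace hist T v) ≡ runTest (bar m) (shape T') (shape T ∷ hist)
run₂ [] hist ph [] = ph , refl
run₂ {m} {T} {T'} (x ∷ v) hist ph ((1≤x , x≤) ∷ ps) with phase₂-berIns ph 1≤x x≤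
... | result₂ ph⁺ cell with run₂ v (shape T ∷ hist) ph⁺ ps
... | end , test = end , trans test
  (cell⇒runTest hist (tbl-pos tT') (tbl-pos tT'⁺) (tbl-pos tT) (tbl-pos tT⁺) (tbl-anti tT') (tbl-anti tT⁺)
    (Cell-cong (pt-shape T') (pt-shape (berIns T' x)) (pt-shape T) (pt-shape (berIns T x)) cell))
  where
  tT   = proj₁ (phase₂-tbl ph)
  tT'  = proj₂ (phase₂-tbl ph)
  tT⁺  = proj₁ (phase₂-tbl ph⁺)
  tT'⁺ = proj₂ (phase₂-tbl ph⁺)

-- Survival or cancellation of the largest letter

data Outcome (M : Letter) (P P' : Tab) (κs : List Shape) (trace : List Shape) : Set where
  kept      : Phase₁ M P P' → Outcome M P P' κs trace
  cancelled : ∀ m → M ≡ bar m → Phase₂ m P P' → runTest (bar m) (shape P') κs ≡ circle →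
              HasRemovalInRow m trace → m ≤ maxℓ trace → Outcome M P P' κs trace

-- After a crossing the rest of the word lies below m̄, hence is at most m, as the second phase
-- requires. The test from the end leads back to the crossing cell and stops there at (○).
run₁ : ∀ {M T T'} v hist → Phase₁ M T T' → All (Under M) v →
  Outcome M (foldl berIns T v) (foldl berIns T' v) (revTrace hist T v) (trace T v)
run₁ [] hist ph [] = kept ph
run₁ {M} {T} {T'} (x ∷ v) hist ph ((1≤x , x<) ∷ ps) with phase₁-berIns ph 1≤x x<
... | stay ph⁺ with run₁ v (shape T ∷ hist) ph⁺ ps
...   | kept end = kept end
...   | cancelled m M≡ end test rem m≤ =
  cancelled m M≡ end test (HasRemoval-∷ {m} {shape T} rem) (≤-trans m≤ (m≤n⊔m (ℓ (shape T)) _))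
run₁ {M} {T} {T'} (x ∷ v) hist ph ((1≤x , x<) ∷ ps) | cross r refl ph⁺ B≗ C≗
  with run₂ v (shape T ∷ hist) ph⁺ (All.map (λ (1≤y , y<) → 1≤y , s≤s⁻¹ y<) ps)
... | end , test = cancelled (suc r) refl end
  (trans test (circle⇒runTest r hist (tbl-pos tT'⁺) (tbl-pos tT) (tbl-pos tT⁺)
    (λ i → trans (pt-shape (berIns T' x) i) (trans (B≗ i) (sym (pt-shape T i)))) C≗'))
  (removal v)
  -- Row r, the m-th, loses a cell at the crossing and so was occupied before it: this gives m ≤ l.
  (≤-trans (pt≢0⇒<ℓ r (tbl-pos tT) (λ eq → contradiction (trans (sym (trans (C≗' r) (inc-at r _))) eq) λ ())) (ℓ≤maxℓ T (x ∷ v)))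
  where
  tT   = proj₁ (phase₁-tbl ph)
  tT⁺  = proj₁ (phase₂-tbl ph⁺)
  tT'⁺ = proj₂ (phase₂-tbl ph⁺)
  C≗' : pt (shape T) ≗ inc r (pt (shape (berIns T x)))
  C≗' i = trans (pt-shape T i) (trans (C≗ i) (inc-cong r (λ j → sym (pt-shape (berIns T x) j)) i))
  removal : ∀ v → HasRemovalInRow (suc r) (trace T (x ∷ v))
  removal []      = here (inc⇒addCell r (tbl-pos tT⁺) (tbl-pos tT) C≗')
  removal (y ∷ v) = here (inc⇒addCell r (tbl-pos tT⁺) (tbl-pos tT) C≗')

phase₁-start : ∀ {M T} → 1 ≤ idx M → Tbl M T → Phase₁ M (berIns T M) T
phase₁-start 1≤M base = contradiction 1≤M λ ()
phase₁-start {M} 1≤M (level {S = S} a lev tS fits bnd) =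
  subst (λ X → Phase₁ M X (ext M S a)) (sym (Next.berIns-ext n))
    (phase₁ {r = 0} a lev tS (Next.fits⁺ n) (Next.bnd⁺ n) λ i ())
  where n = next-max lev tS a fits bnd 1≤M

-- The comparison for a plain largest letter: the empty tableau starts the run of w, the single cell
-- that of w with an m put in front.
phase₂-[] : ∀ {m} → 1 ≤ m → Phase₂ m [] ((plain m ∷ []) ∷ [])
phase₂-[] {suc m} _ = phase₂ {S = []} {r = 0} (λ _ → 0) bar⋖plain (tbl-[] m) (λ _ → z≤n) bnd (λ _ _ → refl)
  where
  bnd : Bounded (plain (suc m)) (inc 0 (λ _ → 0))
  bnd (suc i) _ = refl

reverse-berQ : ∀ w → reverse (berQ w) ≡ revTrace [] [] w
reverse-berQ w = reverse-trace [] [] w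

tbl-empty : ∀ {M} → 1 ≤ idx M → Tbl M []
tbl-empty {plain m} 1≤m = tbl-[]ᵖ 1≤m
tbl-empty {bar m}   _   = tbl-[] m

outcome-split : ∀ {M} u v → 1 ≤ idx M → All (UpTo M) u → All (Under M) v →
  Outcome M (foldl berIns [] (u ++ M ∷ v)) (foldl berIns [] (u ++ v))
    (revTrace [] [] (u ++ M ∷ v)) (trace [] (u ++ M ∷ v))
outcome-split {M} u v 1≤M u≤M v<M
  rewrite foldl-++ berIns [] u v | foldl-++ berIns [] u (M ∷ v) with revTrace-++ [] [] u (M ∷ v)
... | hist , hist≡ rewrite hist≡
  with run₁ v (shape (foldl berIns [] u) ∷ hist) (phase₁-start 1≤M (tbl-run u (tbl-empty 1≤M) u≤M)) v<M
... | kept ph = kept ph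
... | cancelled m M≡ ph test rem m≤ = cancelled m M≡ ph test
  (HasRemoval-++ {m} [] u (M ∷ v) (HasRemoval-∷ {m} {shape (foldl berIns [] u)} rem))
  (≤-trans (≤-trans m≤ (m≤n⊔m (ℓ (shape (foldl berIns [] u))) _)) (maxℓ-++ [] u (M ∷ v)))

outcome : ∀ {M} w → largest w ≡ just M → All (UpTo M) w →
  Outcome M (berP w) (berP (dropLargest w)) (reverse (berQ w)) (berQ w)
outcome {M} w eq w≤M with split-last M w (All.map proj₂ w≤M)
... | inj₁ w<M = contradiction (All.lookup w<M (largest-∈ w eq)) (<-irrefl refl)
... | inj₂ (u , v , refl , v<M)
  rewrite dropLargest-split M u v eq v<M | berP≡foldl (u ++ v) | berP≡foldl (u ++ M ∷ v) | reverse-berQ (u ++ M ∷ v) =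
  outcome-split u v (proj₁ (All.head Mv≤M)) (All.++⁻ˡ u w≤M) (All.zip (All.map proj₁ (All.tail Mv≤M) , v<M))
  where
  Mv≤M : All (UpTo M) (M ∷ v)
  Mv≤M = All.++⁻ʳ u w≤M

-- Reading off the five cases

largest-unique : ∀ xs {x y} → largest xs ≡ just y → x ∈ xs → All (λ z → code z ≤ code x) xs → x ≡ y
largest-unique xs eq x∈ ≤x = code-injective (≤-antisym (All.lookup (largest-≤ xs eq) x∈) (All.lookup ≤x (largest-∈ xs eq)))

phase₁-largest : ∀ {M T T' γ} → Phase₁ M T T' → largest (concat T) ≡ just γ → γ ≡ M
phase₁-largest {T = T} ph eq = sym (largest-unique (concat T) eq (phase₁-∈ ph)
  (All.map s≤s⁻¹ (All.concat⁺ (tbl-below (proj₁ (phase₁-tbl ph))))))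

backTest-≡ : ∀ {m T'} w → Phase₂ m (berP w) T' → backTest m w ≡ runTest (bar m) (shape T') (reverse (berQ w))
backTest-≡ {m} w ph = cong (λ X → runTest (bar m) (shape X) (reverse (berQ w))) (Pbar-correct ph)

-- The second phase covers the whole word, so no cell is a (○). The test comes down to the shape
-- with one cell against the empty shape, where `runTest` computes to `edge`.
backTest-edge : ∀ {m} w → 1 ≤ m → All (UpTo (plain m)) w →
  backTest m w ≡ edge × ∃ λ r → len (Pbar m (berP w)) ≗ inc r (len (berP w))
backTest-edge {m} w 1≤m w≤ with run₂ w [] (phase₂-[] 1≤m) w≤
... | ph , test rewrite sym (berP≡foldl w) =
  trans (backTest-≡ w ph) (trans (cong (runTest (bar m) _) (reverse-berQ w)) test) ,
  proj₁ (phase₂-len ph) , λ i → trans (cong (λ X → len X i) (Pbar-correct ph)) (proj₂ (phase₂-len ph) i)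

cancelled-letters : ∀ {m T T' x} → Phase₂ m T T' → x ∈ concat T → code x ≤ code (plain m)
cancelled-letters ph = tbl-letters (proj₁ (phase₂-tbl ph))

-- Tells P̄, one cell larger than P, from the tableau of the shortened word, one cell smaller when M
-- has survived.
inc-asym : ∀ {r s} {f g : ℕ → ℕ} → f ≗ inc r g → g ≗ inc s f → ⊥
inc-asym {r} {s} {f} {g} p q = contradiction
  (≤-trans (≤-trans (≤-reflexive (sym (inc-at r g))) (≤-reflexive (sym (p r)))) (≤-trans (≤-inc s f r) (≤-reflexive (sym (q r)))))
  (<⇒≱ ≤-refl)

idx-≤⇒code-≤bar : ∀ x {l} → idx x ≤ l → code x ≤ code (bar l)
idx-≤⇒code-≤bar (plain k) le = m≤n⇒m≤1+n (*-monoʳ-≤ 2 le)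
idx-≤⇒code-≤bar (bar k)   le = s≤s (*-monoʳ-≤ 2 le)

not-bar⇒plain : ∀ M → M ≢ bar (idx M) → M ≡ plain (idx M)
not-bar⇒plain (plain k) M≢ = refl
not-bar⇒plain (bar k)   M≢ = contradiction refl M≢

nonempty-largest : ∀ w → 1 ≤ length w → ∃ λ M → largest w ≡ just M
nonempty-largest w 1≤ with largest w in eq
... | just M  = M , refl
... | nothing rewrite largest-nothing w eq = contradiction 1≤ λ ()

1≤largest : ∀ {M} w → largest w ≡ just M → All (UpTo M) w → 1 ≤ idx M
1≤largest w eq w≤M = proj₁ (All.lookup w≤M (largest-∈ w eq))

theorem4p2 : (n : ℕ) (w : List Letter) → 1 ≤ length w → All (InΓ n) w →
    (γ : Letter) → largest (concat (berP w)) ≡ just γ →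
    ((maxℓ (berQ w) < idx γ →
    (largest w ≡ just γ)
    × (berP (dropLargest w) ≡ deleteRightmost γ (berP w)))
    × (idx γ ≤ maxℓ (berQ w) → bar (maxℓ (berQ w)) ∈ concat (berP w) →
    (largest w ≡ just (bar (maxℓ (berQ w))))
    × (berP (dropLargest w) ≡ deleteRightmost (bar (maxℓ (berQ w))) (berP w)))
    × (idx γ ≤ maxℓ (berQ w) → ¬ (bar (maxℓ (berQ w)) ∈ concat (berP w)) →
    ¬ HasRemovalInRow (maxℓ (berQ w)) (berQ w) →
    (largest w ≡ just (plain (maxℓ (berQ w))))
    × (largest (concat (berP w)) ≡ just (plain (maxℓ (berQ w))))
    × (berP (dropLargest w) ≡ deleteRightmost (plain (maxℓ (berQ w))) (berP w)))
    × (idx γ ≤ maxℓ (berQ w) → ¬ (bar (maxℓ (berQ w)) ∈ concat (berP w)) →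
    HasRemovalInRow (maxℓ (berQ w)) (berQ w) →
    backTest (maxℓ (berQ w)) w ≡ edge →
    (berP (dropLargest w) ≢ Pbar (maxℓ (berQ w)) (berP w))
    × (largest w ≡ just (plain (maxℓ (berQ w))))
    × (largest (concat (berP w)) ≡ just (plain (maxℓ (berQ w))))
    × (berP (dropLargest w) ≡ deleteRightmost (plain (maxℓ (berQ w))) (berP w)))
    × (idx γ ≤ maxℓ (berQ w) → ¬ (bar (maxℓ (berQ w)) ∈ concat (berP w)) →
    HasRemovalInRow (maxℓ (berQ w)) (berQ w) →
    backTest (maxℓ (berQ w)) w ≡ circle →
    (berP (dropLargest w) ≡ Pbar (maxℓ (berQ w)) (berP w))
    × (largest w ≡ just (bar (maxℓ (berQ w))))))
theorem4p2 n w 1≤w w∈Γ γ largestP with nonempty-largest w 1≤w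
... | M , largestw = byOutcome M largestw (All.zip (All.map proj₁ w∈Γ , largest-≤ w largestw))
  where
  P = berP w
  l = maxℓ (berQ w)
  byOutcome : ∀ M → largest w ≡ just M → All (UpTo M) w → _
  byOutcome M largestw w≤M
    with maxℓ-bound {M} w (tbl-empty {M} (1≤largest w largestw w≤M)) w≤M | outcome w largestw w≤M
  -- Now m = l. The letters of P are at most `plain l`, against (1) and (2); row l has lost a cell,
  -- against (3); the test ends at a circle, against (4).
  ... | l≤M | cancelled m refl ph test rem m≤l with ≤-antisym m≤l l≤M
  ...   | refl =
    (λ l<γ → contradiction (code-≤⇒idx-≤ γ (plain l) (cancelled-letters ph (largest-∈ (concat P) largestP))) (<⇒≱ l<γ)) ,
    (λ _ bar∈ → contradiction (cancelled-letters ph bar∈) (<⇒≱ ≤-refl)) ,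
    (λ _ _ noRem → contradiction rem noRem) ,
    (λ _ _ _ isEdge → contradiction (trans (sym isEdge) (trans (backTest-≡ w ph) test)) λ ()) ,
    (λ _ _ _ _ → sym (Pbar-correct ph) , largestw)
  -- M survives, so γ = M, and idx M ≤ l leaves only `plain l` and `bar l`. If P lacks `bar l`, then
  -- M = `plain l`, and the test must reach the edge, against (5).
  byOutcome M largestw w≤M | l≤M | kept ph with phase₁-largest ph largestP
  ... | refl =
    (λ _ → largestw , deleted) ,
    (λ M≤l bar∈ → isBar (code-injective (≤-antisym (idx-≤⇒code-≤bar M M≤l) (tbl-letters tP bar∈)))) ,
    (λ M≤l bar∉ _ → isPlain (plain-l M≤l bar∉)) ,
    (λ M≤l bar∉ _ _ → notPbar (plain-l M≤l bar∉) , isPlain (plain-l M≤l bar∉)) ,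
    (λ M≤l bar∉ _ isCircle → contradiction (trans (sym (proj₁ (edgeCase (plain-l M≤l bar∉)))) isCircle) λ ())
    where
    tP = proj₁ (phase₁-tbl ph)
    deleted : berP (dropLargest w) ≡ deleteRightmost M P
    deleted = sym (deleteRightmost-correct ph)
    isBar : M ≡ bar l → largest w ≡ just (bar l) × berP (dropLargest w) ≡ deleteRightmost (bar l) P
    isBar M≡ = trans largestw (cong just M≡) , trans deleted (cong (λ x → deleteRightmost x P) M≡)
    isPlain : M ≡ plain l → largest w ≡ just (plain l) × largest (concat P) ≡ just (plain l) ×
      berP (dropLargest w) ≡ deleteRightmost (plain l) P
    isPlain M≡ = trans largestw (cong just M≡) , trans largestP (cong just M≡) ,
      trans deleted (cong (λ x → deleteRightmost x P) M≡)
    plain-l : idx M ≤ l → ¬ (bar l ∈ concat P) → M ≡ plain l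
    plain-l M≤l bar∉ = trans (not-bar⇒plain M λ M≡ → bar∉ (subst (_∈ concat P) (trans M≡ (cong bar l≡)) (phase₁-∈ ph)))
      (cong plain l≡)
      where
      l≡ : idx M ≡ l
      l≡ = ≤-antisym M≤l l≤M
    edgeCase : M ≡ plain l → backTest l w ≡ edge × ∃ λ r → len (Pbar l P) ≗ inc r (len P)
    edgeCase M≡ = backTest-edge w (subst (λ x → 1 ≤ idx x) M≡ (1≤largest w largestw w≤M))
      (subst (λ x → All (UpTo x) w) M≡ w≤M)
    notPbar : M ≡ plain l → berP (dropLargest w) ≢ Pbar l P
    notPbar M≡ eq with edgeCase M≡ | phase₁-len ph
    ... | _ , r , bigger | s , smaller = inc-asym {r} {s} bigger (λ i → trans (smaller i) (inc-cong s (λ j → cong (λ X → len X j) eq) i))
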